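{- For $n\ge1$ let \[ P_{n}(y,z,s,t)=P_{n}^{(\mathrm{lpk},\mathrm{ilpk},\mathrm{des},\mathrm{ides})}(y,z,s,t)=\sum_{\pi\in\mathfrak{S}_{n}}y^{\mathrm{lpk}(\pi)}z^{\mathrm{ilpk}(\pi)}s^{\mathrm{des}(\pi)}t^{\mathrm{ides}(\pi)}. \] Then, as formal power series, \begin{multline*} \frac{1}{(1-s)(1-t)}+\sum_{n=1}^{\infty}\frac{(1+ys)^{n}(1+zt)^{n}P_{n}\left(\frac{(1+y)^{2}s}{(y+s)(1+ys)},\frac{(1+z)^{2}t}{(z+t)(1+zt)},\frac{y+s}{1+ys},\frac{z+t}{1+zt}\right)}{(1-s)^{n+1}(1-t)^{n+1}}x^{n}\\ =\sum_{i,j=0}^{\infty}\frac{(1+yx)^{i(j+1)}(1+zx)^{(i+1)j}}{(1-yzx)^{ij}(1-x)^{(i+1)(j+1)}}s^{i}t^{j}. \end{multline*}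
   Context: $\mathfrak{S}_n$ is the symmetric group on $[n]$. For $\pi\in\mathfrak{S}_n$: $i\in[n-1]$ is a descent if $\pi(i)>\pi(i+1)$ and $\mathrm{des}(\pi)$ is the number of descents; $i$ with $2\le i\le n-1$ is a peak if $\pi(i-1)<\pi(i)>\pi(i+1)$; $i\in[n-1]$ is a left peak if $i$ is a peak, or if $i=1$ and $\pi(1)>\pi(2)$; $\mathrm{lpk}(\pi)$ is the number of left peaks. Inverse statistics are $\mathrm{ides}(\pi)=\mathrm{des}(\pi^{ -1})$, $\mathrm{ilpk}(\pi)=\mathrm{lpk}(\pi^{ -1})$. -}

module Defs where

open import Level using (Level)
open import Data.Nat as ℕ using (ℕ; zero; suc; _∸_; _<ᵇ_; _≡ᵇ_)
open import Data.Bool using (Bool; true; false; if_then_else_; _∧_; not)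
open import Data.List using (List; []; _∷_; map; concatMap; upTo; filterᵇ)
open import Algebra.Bundles using (CommutativeRing)

-- Permutations of [n], encoded 0-based as lists (π(1),…,π(n)) with
-- values in {0,…,n-1} (a shift of values does not change any statistic).

words : ℕ → ℕ → List (List ℕ)
words n zero    = [] ∷ []
words n (suc k) = concatMap (λ w → map (λ a → a ∷ w) (upTo n)) (words n k)

member : ℕ → List ℕ → Bool
member a []       = false
member a (b ∷ bs) = if a ≡ᵇ b then true else member a bs

distinct : List ℕ → Bool
distinct []       = true
distinct (a ∷ as) = not (member a as) ∧ distinct as

perms : ℕ → List (List ℕ)
perms n = filterᵇ distinct (words n n)

indexOf : ℕ → List ℕ → ℕ
indexOf j []       = zero
indexOf j (a ∷ w)  = if a ≡ᵇ j then zero else suc (indexOf j w)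

inverse : ℕ → List ℕ → List ℕ
inverse n w = map (λ j → indexOf j w) (upTo n)

b2n : Bool → ℕ
b2n true  = 1
b2n false = 0

des : List ℕ → ℕ
des (a ∷ b ∷ w) = b2n (b <ᵇ a) ℕ.+ des (b ∷ w)
des _           = 0

pk : List ℕ → ℕ
pk (a ∷ b ∷ c ∷ w) = b2n ((a <ᵇ b) ∧ (c <ᵇ b)) ℕ.+ pk (b ∷ c ∷ w)
pk _               = 0

lpk : List ℕ → ℕ
lpk (a ∷ b ∷ w) = b2n (b <ᵇ a) ℕ.+ pk (a ∷ b ∷ w)
lpk _           = 0

ides : ℕ → List ℕ → ℕ
ides n w = des (inverse n w)

ilpk : ℕ → List ℕ → ℕ
ilpk n w = lpk (inverse n w)

-- Formal power series in x, s, t over a commutative ring R.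
-- A series is its coefficient function: f n i j = [x^n s^i t^j] f.

module Series {c ℓ : Level} (R : CommutativeRing c ℓ) where
  open CommutativeRing R hiding (zero)

  PS : Set c
  PS = ℕ → ℕ → ℕ → Carrier

  sumTo : ℕ → (ℕ → Carrier) → Carrier
  sumTo zero    f = f zero
  sumTo (suc n) f = sumTo n f + f (suc n)

  sumList : {A : Set} → (A → Carrier) → List A → Carrier
  sumList f []       = 0#
  sumList f (a ∷ as) = f a + sumList f as

  const : Carrier → PS
  const a zero zero zero = a
  const a _    _    _    = 0#

  X S T : PS
  X n i j = if (n ≡ᵇ 1) ∧ (i ≡ᵇ 0) ∧ (j ≡ᵇ 0) then 1# else 0#
  S n i j = if (n ≡ᵇ 0) ∧ (i ≡ᵇ 1) ∧ (j ≡ᵇ 0) then 1# else 0#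
  T n i j = if (n ≡ᵇ 0) ∧ (i ≡ᵇ 0) ∧ (j ≡ᵇ 1) then 1# else 0#

  _⊕_ : PS → PS → PS
  (f ⊕ g) n i j = f n i j + g n i j

  _⊗_ : PS → PS → PS
  (f ⊗ g) n i j =
    sumTo n λ a → sumTo i λ b → sumTo j λ e →
      f a b e * g (n ∸ a) (i ∸ b) (j ∸ e)

  infixl 6 _⊕_
  infixl 7 _⊗_

  pow : PS → ℕ → PS
  pow f zero    = const 1#
  pow f (suc k) = f ⊗ pow f k

  -- geo f = 1/(1 - f) = Σ_k f^k, for f with zero constant term
  -- (the terms with k > n+i+j do not contribute to [x^n s^i t^j]).
  geo : PS → PS
  geo f n i j = sumTo (n ℕ.+ i ℕ.+ j) λ k → pow f k n i j

  sc : Carrier → PS → PS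
  sc a f = const a ⊗ f

module Thm41 {c ℓ : Level} (R : CommutativeRing c ℓ) (y z : CommutativeRing.Carrier R) where
  open CommutativeRing R hiding (zero)
  open Series R

  -- For π with lpk = a, ilpk = b, des = d, ides = e, the monomial
  --   (1+ys)^n (1+zt)^n · U^a V^b W^d Z^e ,
  --   U = (1+y)^2 s/((y+s)(1+ys)), V = (1+z)^2 t/((z+t)(1+zt)),
  --   W = (y+s)/(1+ys),            Z = (z+t)/(1+zt),
  -- written as a power series: since lpk ≤ des and ilpk ≤ ides,
  --   U^a W^d = (1+y)^(2a) s^a (y+s)^(d-a) (1+ys)^(-(a+d)).
  evalTerm : ℕ → List ℕ → PS
  evalTerm n π =
      pow (const (1# + y)) (2 ℕ.* a) ⊗ pow S a ⊗ pow (const y ⊕ S) (d ∸ a)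
        ⊗ pow (const 1# ⊕ sc y S) n ⊗ pow (geo (sc (- y) S)) (a ℕ.+ d)
    ⊗ (pow (const (1# + z)) (2 ℕ.* b) ⊗ pow T b ⊗ pow (const z ⊕ T) (e ∸ b)
        ⊗ pow (const 1# ⊕ sc z T) n ⊗ pow (geo (sc (- z) T)) (b ℕ.+ e))
    where
      a = lpk π
      b = ilpk n π
      d = des π
      e = ides n π

  evalP : ℕ → PS
  evalP n m i j = sumList (λ π → evalTerm n π m i j) (perms n)

  lhsTerm : ℕ → PS
  lhsTerm n = evalP n ⊗ pow (geo S) (suc n) ⊗ pow (geo T) (suc n) ⊗ pow X n

  -- coefficient of x^m s^i t^j on the left; summands with n > m are
  -- divisible by x^n and do not contribute.
  LHS : PS
  LHS m i j = (geo S ⊗ geo T) m i j + sumTo m (λ n → lhsN n)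
    where
      lhsN : ℕ → Carrier
      lhsN zero    = 0#
      lhsN (suc k) = lhsTerm (suc k) m i j

  rhsTerm : ℕ → ℕ → PS
  rhsTerm a b =
    pow (const 1# ⊕ sc y X) (a ℕ.* suc b) ⊗ pow (const 1# ⊕ sc z X) (suc a ℕ.* b)
      ⊗ pow (geo (sc (y * z) X)) (a ℕ.* b) ⊗ pow (geo X) (suc a ℕ.* suc b)
      ⊗ pow S a ⊗ pow T b

  -- coefficient of x^m s^i t^j on the right; summands with a > i or b > j
  -- do not contribute.
  RHS : PS
  RHS m i j = sumTo i λ a → sumTo j λ b → rhsTerm a b m i j

{-# OPTIONS --safe #-}
module Submission where

-- Both sides of the identity, at x^m s^i t^j, count m-element multisets of pairs
-- (p , q) with p in 0 < 1′ < 1 < … < i′ < i and q in 0 < 1′ < 1 < … < j′ < j,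
-- where a pair with exactly one primed entry is not repeated, and every primed
-- p (resp. q) has weight y (resp. z).  The right side is the evident product over
-- all pairs.  On the left, expanding in s, the factor of a permutation π counts the
-- sequences p₁ ≤ … ≤ pₘ that repeat unprimed letters only at ascents of π and primed
-- letters only at descents; likewise in t for π⁻¹.  (Reading the descents of π one at
-- a time, each maximal run of descents contributes (1+y)² s (y+s)^(length-1), and left
-- peaks are in bijection with these runs.)  Standardization of words, with equal primed
-- letters numbered from right to left, turns the sum over π and the second sequence
-- into a sum over all words q₁…qₘ, and sorting the pairs makes the count a product.

-- The bound on the next letter depends on parity, so the number of compatible sequences with an odd
-- bound satisfies no recursion by itself. It is paired with the number for the even bound, and each
-- flag acts on the two generating functions by a small linear system. Its solution shows where the
-- substitution comes from: up to a common `1/(1-s)`, an ascent that does not close a run of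
-- descents multiplies by `1+ys`, entering a run by `1+y`, continuing it by `y+s`, and leaving it by
-- `(1+y)s`. Measured against `(1+ys)^n`, every step of the last three kinds costs one `1/(1+ys)`,
-- and there are `lpk + des` such steps. Standardization goes by induction on the length: deleting
-- the first value `p` of a permutation deletes the minimum of its inverse, which stands at place
-- `p`; for words it deletes the first letter, whose place in the sorted word is then forced to be
-- `p`. In the product, a primed first letter reverses the order of the second letters, so that
-- admitting the pairs one at a time always changes the series by a single factor.

open import Defs
open import Level using (Level; _⊔_)
open import Data.Bool using (Bool; true; false; if_then_else_; _∧_; not; _xor_)
open import Data.Bool.Properties using (not-involutive; xor-identityʳ; xor-comm)
open import Data.Fin using (Fin; zero; suc; toℕ)
import Data.Fin.Properties as Finₚ
open import Data.List as List using (List)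
import Data.List.Properties as Listₚ
open import Data.Nat as ℕ using (ℕ; zero; suc; _∸_; _≤_; _<_; z≤n; s≤s; _<ᵇ_; _≡ᵇ_; _<?_)
import Data.Nat.Properties as ℕₚ
open import Data.Product using (_×_; _,_; proj₁; proj₂)
open import Data.Sum using (inj₁; inj₂)
open import Data.Unit using (⊤; tt)
open import Data.Vec as Vec using (Vec; []; _∷_; toList; insertAt)
import Data.Vec.Properties as Vecₚ
open import Function using (_∘_; id)
open import Function.Bundles using (mk⇔)
open import Algebra.Bundles using (CommutativeRing)
import Algebra.Properties.AbelianGroup as AbelianGroupProperties
import Algebra.Properties.CommutativeSemigroup as CommutativeSemigroupProperties
import Algebra.Properties.CommutativeSemiring.Exp as Exp
import Algebra.Solver.Ring.NaturalCoefficients.Default as SemiringSolver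
open import Relation.Binary.Definitions using (tri<; tri≈; tri>)
open import Relation.Binary.PropositionalEquality as ≡ using (_≡_; _≢_; cong; cong₂; subst)
import Relation.Binary.Reasoning.Setoid as SetoidReasoning
open import Relation.Nullary using (¬_; Dec; yes; no; does; contradiction)
open import Relation.Nullary.Decidable using (_×-dec_; dec-true; dec-false; does-⇔)

-- Power series

module SumTo {c ℓ : Level} (R : CommutativeRing c ℓ) where
  open CommutativeRing R hiding (zero)
  open Series R using (sumTo)
  open CommutativeSemigroupProperties +-commutativeSemigroup using (interchange)

  sumTo-cong-≤ : ∀ n {F G : ℕ → Carrier} → (∀ a → a ≤ n → F a ≈ G a) → sumTo n F ≈ sumTo n G
  sumTo-cong-≤ zero    h = h zero z≤n
  sumTo-cong-≤ (suc n) h =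
    +-cong (sumTo-cong-≤ n λ a a≤n → h a (ℕₚ.m≤n⇒m≤1+n a≤n)) (h (suc n) ℕₚ.≤-refl)

  sumTo-cong : ∀ n {F G : ℕ → Carrier} → (∀ a → F a ≈ G a) → sumTo n F ≈ sumTo n G
  sumTo-cong n h = sumTo-cong-≤ n λ a _ → h a

  sumTo-+ : ∀ n (F G : ℕ → Carrier) → sumTo n (λ a → F a + G a) ≈ sumTo n F + sumTo n G
  sumTo-+ zero    F G = refl
  sumTo-+ (suc n) F G = trans (+-congʳ (sumTo-+ n F G)) (interchange _ _ _ _)

  sumTo-*ˡ : ∀ n k (F : ℕ → Carrier) → sumTo n (λ a → k * F a) ≈ k * sumTo n F
  sumTo-*ˡ zero    k F = refl
  sumTo-*ˡ (suc n) k F = trans (+-congʳ (sumTo-*ˡ n k F)) (sym (distribˡ k _ _))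

  sumTo-first : ∀ n (F : ℕ → Carrier) → sumTo (suc n) F ≈ F 0 + sumTo n (F ∘ suc)
  sumTo-first zero    F = refl
  sumTo-first (suc n) F = trans (+-congʳ (sumTo-first n F)) (+-assoc _ _ _)

  sumTo-zero-≤ : ∀ n {F : ℕ → Carrier} → (∀ a → a ≤ n → F a ≈ 0#) → sumTo n F ≈ 0#
  sumTo-zero-≤ zero    h = h zero z≤n
  sumTo-zero-≤ (suc n) h =
    trans (+-cong (sumTo-zero-≤ n λ a a≤n → h a (ℕₚ.m≤n⇒m≤1+n a≤n)) (h (suc n) ℕₚ.≤-refl))
          (+-identityˡ 0#)

  sumTo-zero : ∀ n {F : ℕ → Carrier} → (∀ a → F a ≈ 0#) → sumTo n F ≈ 0#
  sumTo-zero n h = sumTo-zero-≤ n λ a _ → h a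

  sumTo-single : ∀ n k (F : ℕ → Carrier) → k ≤ n → (∀ a → a ≢ k → F a ≈ 0#) → sumTo n F ≈ F k
  sumTo-single zero    zero F k≤n h = refl
  sumTo-single (suc n) k    F k≤n h with k ℕ.≟ suc n
  ... | yes ≡.refl = trans (+-congʳ (sumTo-zero-≤ n λ a a≤n → h a (ℕₚ.<⇒≢ (s≤s a≤n)))) (+-identityˡ _)
  ... | no  k≢     = trans (+-cong (sumTo-single n k F (ℕₚ.≤-pred (ℕₚ.≤∧≢⇒< k≤n k≢)) h)
                                   (h (suc n) (k≢ ∘ ≡.sym)))
                           (+-identityʳ _)

module PowerSeries {c ℓ : Level} (R : CommutativeRing c ℓ) where
  open CommutativeRing R hiding (zero)
  open Series R using (sumTo)
  open SumTo R
  open SemiringSolver commutativeSemiring using (solve; _:+_; _:*_; _:=_)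
  open SetoidReasoning setoid

  infixl 7 _⋆_
  _⋆_ : (ℕ → Carrier) → (ℕ → Carrier) → ℕ → Carrier
  (f ⋆ g) n = sumTo n λ a → f a * g (n ∸ a)

  one : ℕ → Carrier
  one zero    = 1#
  one (suc _) = 0#

  infix 4 _≋_
  _≋_ : (ℕ → Carrier) → (ℕ → Carrier) → Set ℓ
  f ≋ g = ∀ n → f n ≈ g n

  ⋆-cong : ∀ {f f′ g g′} → f ≋ f′ → g ≋ g′ → f ⋆ g ≋ f′ ⋆ g′
  ⋆-cong p q n = sumTo-cong n λ a → *-cong (p a) (q (n ∸ a))

  ⋆-sucˡ : ∀ f g n → (f ⋆ g) (suc n) ≈ f 0 * g (suc n) + (f ∘ suc ⋆ g) n
  ⋆-sucˡ f g n = sumTo-first n _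

  ⋆-sucʳ : ∀ f g n → (f ⋆ g) (suc n) ≈ (f ⋆ g ∘ suc) n + f (suc n) * g 0
  ⋆-sucʳ f g zero    = refl
  ⋆-sucʳ f g (suc n) = begin
    (f ⋆ g) (suc (suc n))                                             ≈⟨ ⋆-sucˡ f g (suc n) ⟩
    f 0 * g (suc (suc n)) + (f ∘ suc ⋆ g) (suc n)                     ≈⟨ +-congˡ (⋆-sucʳ (f ∘ suc) g n) ⟩
    f 0 * g (suc (suc n)) + ((f ∘ suc ⋆ g ∘ suc) n + _)               ≈⟨ +-assoc _ _ _ ⟨
    f 0 * g (suc (suc n)) + (f ∘ suc ⋆ g ∘ suc) n + _                 ≈⟨ +-congʳ (⋆-sucˡ f (g ∘ suc) n) ⟨
    (f ⋆ g ∘ suc) (suc n) + f (suc (suc n)) * g 0                     ∎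

  ⋆-comm : ∀ f g → f ⋆ g ≋ g ⋆ f
  ⋆-comm f g zero    = *-comm _ _
  ⋆-comm f g (suc n) = begin
    (f ⋆ g) (suc n)                        ≈⟨ ⋆-sucˡ f g n ⟩
    f 0 * g (suc n) + (f ∘ suc ⋆ g) n      ≈⟨ +-cong (*-comm _ _) (⋆-comm (f ∘ suc) g n) ⟩
    g (suc n) * f 0 + (g ⋆ f ∘ suc) n      ≈⟨ +-comm _ _ ⟩
    (g ⋆ f ∘ suc) n + g (suc n) * f 0      ≈⟨ ⋆-sucʳ g f n ⟨
    (g ⋆ f) (suc n)                        ∎

  ⋆-distribʳ : ∀ f g h n → ((λ k → g k + h k) ⋆ f) n ≈ (g ⋆ f) n + (h ⋆ f) n
  ⋆-distribʳ f g h n = trans (sumTo-cong n λ a → distribʳ _ _ _) (sumTo-+ n _ _)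

  ⋆-distribˡ : ∀ f g h n → (f ⋆ (λ k → g k + h k)) n ≈ (f ⋆ g) n + (f ⋆ h) n
  ⋆-distribˡ f g h n = trans (sumTo-cong n λ a → distribˡ _ _ _) (sumTo-+ n _ _)

  ⋆-scaleˡ : ∀ k f g n → ((λ a → k * f a) ⋆ g) n ≈ k * (f ⋆ g) n
  ⋆-scaleˡ k f g n = trans (sumTo-cong n λ a → *-assoc _ _ _) (sumTo-*ˡ n k _)

  ⋆-assoc : ∀ f g h → (f ⋆ g) ⋆ h ≋ f ⋆ (g ⋆ h)
  ⋆-assoc f g h zero    = *-assoc _ _ _
  ⋆-assoc f g h (suc n) = begin
    ((f ⋆ g) ⋆ h) (suc n)
      ≈⟨ ⋆-sucˡ (f ⋆ g) h n ⟩
    f 0 * g 0 * h (suc n) + ((f ⋆ g) ∘ suc ⋆ h) n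
      ≈⟨ +-congˡ (⋆-cong {g = h} (⋆-sucˡ f g) (λ _ → refl) n) ⟩
    f 0 * g 0 * h (suc n) + ((λ k → f 0 * g (suc k) + (f ∘ suc ⋆ g) k) ⋆ h) n
      ≈⟨ +-congˡ (⋆-distribʳ h _ _ n) ⟩
    f 0 * g 0 * h (suc n) + (((λ k → f 0 * g (suc k)) ⋆ h) n + ((f ∘ suc ⋆ g) ⋆ h) n)
      ≈⟨ +-congˡ (+-cong (⋆-scaleˡ (f 0) (g ∘ suc) h n) (⋆-assoc (f ∘ suc) g h n)) ⟩
    f 0 * g 0 * h (suc n) + (f 0 * (g ∘ suc ⋆ h) n + (f ∘ suc ⋆ (g ⋆ h)) n)
      ≈⟨ solve 5 (λ a b c d e → a :* b :* c :+ (a :* d :+ e) := a :* (b :* c :+ d) :+ e) refl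
           (f 0) (g 0) (h (suc n)) ((g ∘ suc ⋆ h) n) ((f ∘ suc ⋆ (g ⋆ h)) n) ⟩
    f 0 * (g 0 * h (suc n) + (g ∘ suc ⋆ h) n) + (f ∘ suc ⋆ (g ⋆ h)) n
      ≈⟨ +-congʳ (*-congˡ (⋆-sucˡ g h n)) ⟨
    f 0 * (g ⋆ h) (suc n) + (f ∘ suc ⋆ (g ⋆ h)) n
      ≈⟨ ⋆-sucˡ f (g ⋆ h) n ⟨
    (f ⋆ (g ⋆ h)) (suc n) ∎

  ⋆-identityˡ : ∀ f → one ⋆ f ≋ f
  ⋆-identityˡ f zero    = *-identityˡ _
  ⋆-identityˡ f (suc n) = begin
    (one ⋆ f) (suc n)                       ≈⟨ ⋆-sucˡ one f n ⟩
    1# * f (suc n) + (one ∘ suc ⋆ f) n      ≈⟨ +-cong (*-identityˡ _) (sumTo-zero n λ a → zeroˡ _) ⟩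
    f (suc n) + 0#                          ≈⟨ +-identityʳ _ ⟩
    f (suc n)                               ∎

  powerSeriesRing : CommutativeRing c ℓ
  powerSeriesRing = record
    { Carrier = ℕ → Carrier
    ; _≈_     = _≋_
    ; _+_     = λ f g n → f n + g n
    ; _*_     = _⋆_
    ; -_      = λ f n → - f n
    ; 0#      = λ _ → 0#
    ; 1#      = one
    ; isCommutativeRing = record
      { isRing = record
        { +-isAbelianGroup = record
          { isGroup = record
            { isMonoid = record
              { isSemigroup = record
                { isMagma = record
                  { isEquivalence = record
                    { refl  = λ _ → refl
                    ; sym   = λ p n → sym (p n)
                    ; trans = λ p q n → trans (p n) (q n)
                    }
                  ; ∙-cong = λ p q n → +-cong (p n) (q n)
                  }
                ; assoc = λ f g h n → +-assoc _ _ _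
                }
              ; identity = (λ f n → +-identityˡ _) , (λ f n → +-identityʳ _)
              }
            ; inverse = (λ f n → -‿inverseˡ _) , (λ f n → -‿inverseʳ _)
            ; ⁻¹-cong = λ p n → -‿cong (p n)
            }
          ; comm = λ f g n → +-comm _ _
          }
        ; *-cong     = ⋆-cong
        ; *-assoc    = ⋆-assoc
        ; *-identity = ⋆-identityˡ , (λ f n → trans (⋆-comm f one n) (⋆-identityˡ f n))
        ; distrib    = ⋆-distribˡ , ⋆-distribʳ
        }
      ; *-comm = ⋆-comm
      }
    }

  sumTo-apply : ∀ n (F : ℕ → ℕ → Carrier) i →
    Series.sumTo powerSeriesRing n F i ≈ sumTo n (λ a → F a i)
  sumTo-apply zero    F i = refl
  sumTo-apply (suc n) F i = +-congʳ (sumTo-apply n F i)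

-- emb f stands for Σₙ f(n) Vⁿ.
record Embedding {c ℓ : Level} (R K : CommutativeRing c ℓ)
  (ι : CommutativeRing.Carrier R → CommutativeRing.Carrier K)
  (V : CommutativeRing.Carrier K) : Set (c ⊔ ℓ) where
  private
    module R = CommutativeRing R
    module K = CommutativeRing K
  field
    emb       : (ℕ → R.Carrier) → K.Carrier
    emb-cong  : ∀ {f g} → (∀ n → f n R.≈ g n) → emb f K.≈ emb g
    emb-+     : ∀ f g → emb (λ n → f n R.+ g n) K.≈ emb f K.+ emb g
    emb-scale : ∀ k f → emb (λ n → k R.* f n) K.≈ ι k K.* emb f
    emb-step  : ∀ f → emb f K.≈ ι (f 0) K.+ V K.* emb (f ∘ suc)

module TrivariateSeries {c ℓ : Level} (R : CommutativeRing c ℓ) where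
  open CommutativeRing R hiding (zero)
  open Series R
  open SumTo R
  private
    module P₁ = PowerSeries R
    module P₂ = PowerSeries P₁.powerSeriesRing
    module P₃ = PowerSeries P₂.powerSeriesRing
    module C₃ = CommutativeRing P₃.powerSeriesRing

  -- Read as series in `X` over series in `S` over series in `T`, the triple convolution is an
  -- iterated single one. The ring laws of `seriesRing` are transported along this equation instead
  -- of being proved with triple sums.
  ⊗≈⋆ : ∀ f g n i j → (f ⊗ g) n i j ≈ (f C₃.* g) n i j
  ⊗≈⋆ f g n i j = sym (trans (P₂.sumTo-apply n _ i j) (trans (P₁.sumTo-apply n _ j)
    (sumTo-cong n λ a → P₁.sumTo-apply i _ j)))

  infix 4 _≈ₛ_
  _≈ₛ_ : PS → PS → Set ℓ
  f ≈ₛ g = ∀ n i j → f n i j ≈ g n i j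

  const-1≈one : const 1# ≈ₛ C₃.1#
  const-1≈one zero    zero    zero    = refl
  const-1≈one zero    zero    (suc j) = refl
  const-1≈one zero    (suc i) j       = refl
  const-1≈one (suc n) i       j       = refl

  seriesRing : CommutativeRing c ℓ
  seriesRing = record
    { Carrier = PS
    ; _≈_     = _≈ₛ_
    ; _+_     = _⊕_
    ; _*_     = _⊗_
    ; -_      = λ f n i j → - f n i j
    ; 0#      = λ _ _ _ → 0#
    ; 1#      = const 1#
    ; isCommutativeRing = record
      { isRing = record
        { +-isAbelianGroup = C₃.+-isAbelianGroup
        ; *-cong     = ⊗-cong
        ; *-assoc    = λ f g h → via (f ⊗ g) h (C₃.trans (C₃.*-congʳ {h} (⊗≈⋆ f g)) (C₃.trans
                         (C₃.*-assoc f g h) (C₃.trans (C₃.sym (C₃.*-congˡ {f} (⊗≈⋆ g h))) (C₃.sym (⊗≈⋆ f (g ⊗ h))))))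
        ; *-identity = idˡ , (λ f → C₃.trans (comm f (const 1#)) (idˡ f))
        ; distrib    = (λ f g h → via f (g ⊕ h) (C₃.trans (C₃.distribˡ f g h)
                         (C₃.sym (C₃.+-cong (⊗≈⋆ f g) (⊗≈⋆ f h)))))
                     , (λ f g h → via (g ⊕ h) f (C₃.trans (C₃.distribʳ f g h)
                         (C₃.sym (C₃.+-cong (⊗≈⋆ g f) (⊗≈⋆ h f)))))
        }
      ; *-comm = comm
      }
    }
    where
    via : ∀ f g {h} → f C₃.* g ≈ₛ h → f ⊗ g ≈ₛ h
    via f g p = C₃.trans (⊗≈⋆ f g) p
    ⊗-cong : ∀ {f f′ g g′} → f ≈ₛ f′ → g ≈ₛ g′ → f ⊗ g ≈ₛ f′ ⊗ g′
    ⊗-cong p q n i j = sumTo-cong n λ a → sumTo-cong i λ b → sumTo-cong j λ e →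
      *-cong (p a b e) (q (n ∸ a) (i ∸ b) (j ∸ e))
    comm : ∀ f g → f ⊗ g ≈ₛ g ⊗ f
    comm f g = via f g (C₃.trans (C₃.*-comm f g) (C₃.sym (⊗≈⋆ g f)))
    idˡ : ∀ f → const 1# ⊗ f ≈ₛ f
    idˡ f = via (const 1#) f (C₃.trans (C₃.*-congʳ {f} const-1≈one) (C₃.*-identityˡ f))

  private module K = CommutativeRing seriesRing

  ⊗-single : ∀ f g p q r → (∀ a b e → ¬ (a ≡ p × b ≡ q × e ≡ r) → f a b e ≈ 0#) →
    ∀ {n i j} → p ≤ n → q ≤ i → r ≤ j → (f ⊗ g) n i j ≈ f p q r * g (n ∸ p) (i ∸ q) (j ∸ r)
  ⊗-single f g p q r h {n} {i} {j} p≤n q≤i r≤j =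
    trans (sumTo-single n p _ p≤n λ a a≢ → sumTo-zero i λ b → sumTo-zero j λ e → vanish λ s → a≢ (proj₁ s))
      (trans (sumTo-single i q _ q≤i λ b b≢ → sumTo-zero j λ e → vanish λ s → b≢ (proj₁ (proj₂ s)))
        (sumTo-single j r _ r≤j λ e e≢ → vanish λ s → e≢ (proj₂ (proj₂ s))))
    where
    vanish : ∀ {a b e k} → ¬ (a ≡ p × b ≡ q × e ≡ r) → f a b e * k ≈ 0#
    vanish s = trans (*-congʳ (h _ _ _ s)) (zeroˡ _)

  const-⊗ : ∀ k f n i j → (const k ⊗ f) n i j ≈ k * f n i j
  const-⊗ k f n i j = ⊗-single (const k) f 0 0 0 off z≤n z≤n z≤n
    where
    off : ∀ a b e → ¬ (a ≡ 0 × b ≡ 0 × e ≡ 0) → const k a b e ≈ 0#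
    off zero    zero    zero    h = contradiction (≡.refl , ≡.refl , ≡.refl) h
    off zero    zero    (suc e) h = refl
    off zero    (suc b) e       h = refl
    off (suc a) b       e       h = refl

  X-⊗-suc : ∀ f n i j → (X ⊗ f) (suc n) i j ≈ f n i j
  X-⊗-suc f n i j = trans (⊗-single X f 1 0 0 off (s≤s z≤n) z≤n z≤n) (*-identityˡ _)
    where
    off : ∀ a b e → ¬ (a ≡ 1 × b ≡ 0 × e ≡ 0) → X a b e ≈ 0#
    off zero          b       e       h = refl
    off (suc (suc a)) b       e       h = refl
    off 1             (suc b) e       h = refl
    off 1             zero    (suc e) h = refl
    off 1             zero    zero    h = contradiction (≡.refl , ≡.refl , ≡.refl) h

  S-⊗-suc : ∀ f n i j → (S ⊗ f) n (suc i) j ≈ f n i j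
  S-⊗-suc f n i j = trans (⊗-single S f 0 1 0 off z≤n (s≤s z≤n) z≤n) (*-identityˡ _)
    where
    off : ∀ a b e → ¬ (a ≡ 0 × b ≡ 1 × e ≡ 0) → S a b e ≈ 0#
    off (suc a) b             e       h = refl
    off zero    zero          e       h = refl
    off zero    (suc (suc b)) e       h = refl
    off zero    1             (suc e) h = refl
    off zero    1             zero    h = contradiction (≡.refl , ≡.refl , ≡.refl) h

  T-⊗-suc : ∀ f n i j → (T ⊗ f) n i (suc j) ≈ f n i j
  T-⊗-suc f n i j = trans (⊗-single T f 0 0 1 off z≤n z≤n (s≤s z≤n)) (*-identityˡ _)
    where
    off : ∀ a b e → ¬ (a ≡ 0 × b ≡ 0 × e ≡ 1) → T a b e ≈ 0#
    off (suc a) b       e             h = refl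
    off zero    (suc b) e             h = refl
    off zero    zero    zero          h = refl
    off zero    zero    (suc (suc e)) h = refl
    off zero    zero    1             h = contradiction (≡.refl , ≡.refl , ≡.refl) h

  X-⊗-zero : ∀ f i j → (X ⊗ f) 0 i j ≈ 0#
  X-⊗-zero f i j = sumTo-zero i λ b → sumTo-zero j λ e → zeroˡ _

  S-⊗-zero : ∀ f n j → (S ⊗ f) n 0 j ≈ 0#
  S-⊗-zero f n j = sumTo-zero n λ a → sumTo-zero j λ e → trans (*-congʳ (off a e)) (zeroˡ _)
    where
    off : ∀ a e → S a 0 e ≈ 0#
    off zero    e = refl
    off (suc a) e = refl

  T-⊗-zero : ∀ f n i → (T ⊗ f) n i 0 ≈ 0#
  T-⊗-zero f n i = sumTo-zero n λ a → sumTo-zero i λ b → trans (*-congʳ (off a b)) (zeroˡ _)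
    where
    off : ∀ a b → T a b 0 ≈ 0#
    off zero    zero    = refl
    off zero    (suc b) = refl
    off (suc a) b       = refl

  const-cong : ∀ {a b} → a ≈ b → const a ≈ₛ const b
  const-cong p zero    zero    zero    = p
  const-cong p zero    zero    (suc j) = refl
  const-cong p zero    (suc i) j       = refl
  const-cong p (suc n) i       j       = refl

  const-+ : ∀ a b → const (a + b) ≈ₛ const a ⊕ const b
  const-+ a b zero    zero    zero    = refl
  const-+ a b zero    zero    (suc j) = sym (+-identityˡ _)
  const-+ a b zero    (suc i) j       = sym (+-identityˡ _)
  const-+ a b (suc n) i       j       = sym (+-identityˡ _)

  const-0 : const 0# ≈ₛ K.0#
  const-0 zero    zero    zero    = refl
  const-0 zero    zero    (suc j) = refl
  const-0 zero    (suc i) j       = refl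
  const-0 (suc n) i       j       = refl

  module Geo (f : PS) (f₀ : f 0 0 0 ≈ 0#) where

    private
      deg : ℕ → ℕ → ℕ → ℕ
      deg n i j = n ℕ.+ i ℕ.+ j

      deg-∸-≤ : ∀ n i j a b e → deg (n ∸ a) (i ∸ b) (j ∸ e) ≤ deg n i j
      deg-∸-≤ n i j a b e = ℕₚ.+-mono-≤ (ℕₚ.+-mono-≤ (ℕₚ.m∸n≤m n a) (ℕₚ.m∸n≤m i b)) (ℕₚ.m∸n≤m j e)

      ∸-suc-< : ∀ {n a} → suc a ≤ n → n ∸ suc a < n
      ∸-suc-< {suc n} {a} _ = s≤s (ℕₚ.m∸n≤m n a)

      ⊗-vanish : ∀ k g → (∀ n i j → deg n i j < k → g n i j ≈ 0#) →
        ∀ n i j → deg n i j < suc k → (f ⊗ g) n i j ≈ 0#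
      ⊗-vanish k g h n i j d = sumTo-zero-≤ n λ a a≤ → sumTo-zero-≤ i λ b b≤ → sumTo-zero-≤ j λ e e≤ → term a b e a≤ b≤ e≤
        where
        lower : ∀ a b e → deg (n ∸ a) (i ∸ b) (j ∸ e) < deg n i j →
          f a b e * g (n ∸ a) (i ∸ b) (j ∸ e) ≈ 0#
        lower a b e lt = trans (*-congˡ (h _ _ _ (ℕₚ.≤-trans lt (ℕₚ.≤-pred d)))) (zeroʳ _)
        term : ∀ a b e → a ≤ n → b ≤ i → e ≤ j → f a b e * g (n ∸ a) (i ∸ b) (j ∸ e) ≈ 0#
        term zero zero zero _ _ _ = trans (*-congʳ f₀) (zeroˡ _)
        term zero zero (suc e) _ _ e≤ = lower 0 0 (suc e) (ℕₚ.+-monoʳ-< (n ℕ.+ i) (∸-suc-< e≤))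
        term zero (suc b) e _ b≤ _ =
          lower 0 (suc b) e (ℕₚ.+-mono-<-≤ (ℕₚ.+-monoʳ-< n (∸-suc-< b≤)) (ℕₚ.m∸n≤m j e))
        term (suc a) b e a≤ _ _ =
          lower (suc a) b e (ℕₚ.+-mono-<-≤ (ℕₚ.+-mono-<-≤ (∸-suc-< a≤) (ℕₚ.m∸n≤m i b)) (ℕₚ.m∸n≤m j e))

      pow-vanish : ∀ k n i j → deg n i j < k → pow f k n i j ≈ 0#
      pow-vanish (suc k) = ⊗-vanish k (pow f k) (pow-vanish k)

      partialSum : ℕ → PS
      partialSum N n i j = sumTo N λ k → pow f k n i j

      partialSum-suc : ∀ N → partialSum (suc N) ≈ₛ const 1# ⊕ f ⊗ partialSum N
      partialSum-suc zero    = K.refl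
      partialSum-suc (suc N) = K.trans (K.+-congʳ (partialSum-suc N))
        (K.trans (K.+-assoc (const 1#) (f ⊗ partialSum N) (pow f (suc (suc N))))
          (K.+-congˡ {const 1#} (K.sym (K.distribˡ f (partialSum N) (pow f (suc N))))))

      partialSum-stable : ∀ k {N n i j} → deg n i j ≤ N →
        partialSum (k ℕ.+ N) n i j ≈ partialSum N n i j
      partialSum-stable zero    d = refl
      partialSum-stable (suc k) {N} {n} {i} {j} d =
        trans (+-cong (partialSum-stable k d) (pow-vanish (suc k ℕ.+ N) n i j (s≤s (ℕₚ.≤-trans d (ℕₚ.m≤n+m N k)))))
              (+-identityʳ _)

      geo≈partialSum : ∀ {N n i j} → deg n i j ≤ N → geo f n i j ≈ partialSum N n i j
      geo≈partialSum {N} {n} {i} {j} d = trans (sym (partialSum-stable (N ∸ deg n i j) ℕₚ.≤-refl))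
        (reflexive (≡.cong (λ M → partialSum M n i j) (ℕₚ.m∸n+n≡m d)))

    -- Without a constant term, `pow f k` starts in total degree `k`, so the truncation in `geo` may
    -- be replaced by any longer one; lengthening it by one term exposes the recursion. Later
    -- arguments use `geo` only through this equation.
    geo-unfold : geo f ≈ₛ const 1# ⊕ f ⊗ geo f
    geo-unfold n i j = trans (sym (partialSum-stable 1 {deg n i j} {n} {i} {j} ℕₚ.≤-refl)) (trans (partialSum-suc (deg n i j) n i j)
      (+-congˡ (sumTo-cong n λ a → sumTo-cong i λ b → sumTo-cong j λ e →
        *-congˡ {f a b e} (sym (geo≈partialSum (deg-∸-≤ n i j a b e))))))

  open Geo public using (geo-unfold)

  embX : (ℕ → Carrier) → PS
  embX f n zero zero = f n
  embX f n zero (suc j) = 0#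
  embX f n (suc i) j = 0#

  embeddingX : Embedding R seriesRing const X
  embeddingX = record
    { emb = embX ; emb-cong = resp ; emb-+ = add ; emb-scale = scale ; emb-step = step }
    where
    resp : ∀ {f g} → (∀ n → f n ≈ g n) → embX f ≈ₛ embX g
    resp p n zero zero = p n
    resp p n zero (suc j) = refl
    resp p n (suc i) j = refl
    add : ∀ f g → embX (λ n → f n + g n) ≈ₛ embX f ⊕ embX g
    add f g n zero zero = refl
    add f g n zero (suc j) = sym (+-identityˡ 0#)
    add f g n (suc i) j = sym (+-identityˡ 0#)
    scale : ∀ k f → embX (λ n → k * f n) ≈ₛ const k ⊗ embX f
    scale k f n zero zero = sym (const-⊗ k (embX f) n zero zero)
    scale k f n zero (suc j) = trans (sym (zeroʳ k)) (sym (const-⊗ k (embX f) n zero (suc j)))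
    scale k f n (suc i) j = trans (sym (zeroʳ k)) (sym (const-⊗ k (embX f) n (suc i) j))
    step : ∀ f → embX f ≈ₛ const (f 0) ⊕ X ⊗ embX (f ∘ suc)
    step f zero zero zero = sym (trans (+-congˡ (X-⊗-zero (embX (f ∘ suc)) zero zero)) (+-identityʳ _))
    step f zero zero (suc j) = sym (trans (+-congˡ (X-⊗-zero (embX (f ∘ suc)) zero (suc j))) (+-identityʳ _))
    step f zero (suc i) j = sym (trans (+-congˡ (X-⊗-zero (embX (f ∘ suc)) (suc i) j)) (+-identityʳ _))
    step f (suc n) zero zero = sym (trans (+-congˡ (X-⊗-suc (embX (f ∘ suc)) n zero zero)) (+-identityˡ _))
    step f (suc n) zero (suc j) = sym (trans (+-congˡ (X-⊗-suc (embX (f ∘ suc)) n zero (suc j))) (+-identityˡ _))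
    step f (suc n) (suc i) j = sym (trans (+-congˡ (X-⊗-suc (embX (f ∘ suc)) n (suc i) j)) (+-identityˡ _))

  embS : (ℕ → Carrier) → PS
  embS f zero i zero = f i
  embS f zero i (suc j) = 0#
  embS f (suc n) i j = 0#

  embeddingS : Embedding R seriesRing const S
  embeddingS = record
    { emb = embS ; emb-cong = resp ; emb-+ = add ; emb-scale = scale ; emb-step = step }
    where
    resp : ∀ {f g} → (∀ n → f n ≈ g n) → embS f ≈ₛ embS g
    resp p zero i zero = p i
    resp p zero i (suc j) = refl
    resp p (suc n) i j = refl
    add : ∀ f g → embS (λ n → f n + g n) ≈ₛ embS f ⊕ embS g
    add f g zero i zero = refl
    add f g zero i (suc j) = sym (+-identityˡ 0#)
    add f g (suc n) i j = sym (+-identityˡ 0#)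
    scale : ∀ k f → embS (λ n → k * f n) ≈ₛ const k ⊗ embS f
    scale k f zero i zero = sym (const-⊗ k (embS f) zero i zero)
    scale k f zero i (suc j) = trans (sym (zeroʳ k)) (sym (const-⊗ k (embS f) zero i (suc j)))
    scale k f (suc n) i j = trans (sym (zeroʳ k)) (sym (const-⊗ k (embS f) (suc n) i j))
    step : ∀ f → embS f ≈ₛ const (f 0) ⊕ S ⊗ embS (f ∘ suc)
    step f zero zero zero = sym (trans (+-congˡ (S-⊗-zero (embS (f ∘ suc)) zero zero)) (+-identityʳ _))
    step f zero zero (suc j) = sym (trans (+-congˡ (S-⊗-zero (embS (f ∘ suc)) zero (suc j))) (+-identityʳ _))
    step f (suc n) zero j = sym (trans (+-congˡ (S-⊗-zero (embS (f ∘ suc)) (suc n) j)) (+-identityʳ _))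
    step f zero (suc i) zero = sym (trans (+-congˡ (S-⊗-suc (embS (f ∘ suc)) zero i zero)) (+-identityˡ _))
    step f zero (suc i) (suc j) = sym (trans (+-congˡ (S-⊗-suc (embS (f ∘ suc)) zero i (suc j))) (+-identityˡ _))
    step f (suc n) (suc i) j = sym (trans (+-congˡ (S-⊗-suc (embS (f ∘ suc)) (suc n) i j)) (+-identityˡ _))

  embT : (ℕ → Carrier) → PS
  embT f zero zero j = f j
  embT f zero (suc i) j = 0#
  embT f (suc n) i j = 0#

  embeddingT : Embedding R seriesRing const T
  embeddingT = record
    { emb = embT ; emb-cong = resp ; emb-+ = add ; emb-scale = scale ; emb-step = step }
    where
    resp : ∀ {f g} → (∀ n → f n ≈ g n) → embT f ≈ₛ embT g
    resp p zero zero j = p j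
    resp p zero (suc i) j = refl
    resp p (suc n) i j = refl
    add : ∀ f g → embT (λ n → f n + g n) ≈ₛ embT f ⊕ embT g
    add f g zero zero j = refl
    add f g zero (suc i) j = sym (+-identityˡ 0#)
    add f g (suc n) i j = sym (+-identityˡ 0#)
    scale : ∀ k f → embT (λ n → k * f n) ≈ₛ const k ⊗ embT f
    scale k f zero zero j = sym (const-⊗ k (embT f) zero zero j)
    scale k f zero (suc i) j = trans (sym (zeroʳ k)) (sym (const-⊗ k (embT f) zero (suc i) j))
    scale k f (suc n) i j = trans (sym (zeroʳ k)) (sym (const-⊗ k (embT f) (suc n) i j))
    step : ∀ f → embT f ≈ₛ const (f 0) ⊕ T ⊗ embT (f ∘ suc)
    step f zero zero zero = sym (trans (+-congˡ (T-⊗-zero (embT (f ∘ suc)) zero zero)) (+-identityʳ _))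
    step f zero (suc i) zero = sym (trans (+-congˡ (T-⊗-zero (embT (f ∘ suc)) zero (suc i))) (+-identityʳ _))
    step f (suc n) i zero = sym (trans (+-congˡ (T-⊗-zero (embT (f ∘ suc)) (suc n) i)) (+-identityʳ _))
    step f zero zero (suc j) = sym (trans (+-congˡ (T-⊗-suc (embT (f ∘ suc)) zero zero j)) (+-identityˡ _))
    step f zero (suc i) (suc j) = sym (trans (+-congˡ (T-⊗-suc (embT (f ∘ suc)) zero (suc i) j)) (+-identityˡ _))
    step f (suc n) i (suc j) = sym (trans (+-congˡ (T-⊗-suc (embT (f ∘ suc)) (suc n) i j)) (+-identityˡ _))

  -- `coef` reads a coefficient in one variable with the other two exponents fixed, so that one
  -- argument serves `X`, `S` and `T`.
  module Shift (V : PS) (coef : PS → ℕ → Carrier)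
    (coef-cong : ∀ {f g} → f ≈ₛ g → ∀ n → coef f n ≈ coef g n)
    (coef-zero : ∀ f → coef (V ⊗ f) 0 ≈ 0#)
    (coef-suc : ∀ f n → coef (V ⊗ f) (suc n) ≈ coef f n)
    where

    open CommutativeSemigroupProperties K.*-commutativeSemigroup using (x∙yz≈y∙xz)

    coef-pow-diagonal : ∀ f k → coef (f ⊗ pow V k) k ≈ coef f 0
    coef-pow-diagonal f zero    = coef-cong (K.*-identityʳ f) 0
    coef-pow-diagonal f (suc k) =
      trans (coef-cong (x∙yz≈y∙xz f V (pow V k)) (suc k)) (trans (coef-suc (f ⊗ pow V k) k) (coef-pow-diagonal f k))

    coef-pow-off : ∀ f → (∀ n → coef f (suc n) ≈ 0#) → ∀ k n → k ≢ n → coef (f ⊗ pow V k) n ≈ 0#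
    coef-pow-off f h zero    zero    k≢n = contradiction ≡.refl k≢n
    coef-pow-off f h zero    (suc n) k≢n = trans (coef-cong (K.*-identityʳ f) (suc n)) (h n)
    coef-pow-off f h (suc k) n       k≢n = trans (coef-cong (x∙yz≈y∙xz f V (pow V k)) n) (shift n k≢n)
      where
      shift : ∀ n → suc k ≢ n → coef (V ⊗ (f ⊗ pow V k)) n ≈ 0#
      shift zero    _  = coef-zero (f ⊗ pow V k)
      shift (suc n) ne = trans (coef-suc (f ⊗ pow V k) n) (coef-pow-off f h k n (ne ∘ ≡.cong suc))

  module ShiftX (i j : ℕ) = Shift X (λ f n → f n i j) (λ p n → p n i j) (λ f → X-⊗-zero f i j) (λ f n → X-⊗-suc f n i j)
  module ShiftS (n j : ℕ) = Shift S (λ f i → f n i j) (λ p i → p n i j) (λ f → S-⊗-zero f n j) (λ f i → S-⊗-suc f n i j)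
  module ShiftT (n i : ℕ) = Shift T (λ f j → f n i j) (λ p j → p n i j) (λ f → T-⊗-zero f n i) (λ f j → T-⊗-suc f n i j)

  embS-⊗ : ∀ f g → (∀ n i j → g n (suc i) j ≈ 0#) → ∀ n i j → (embS f ⊗ g) n i j ≈ f i * g n 0 j
  embS-⊗ f g h n i j = trans (K.trans (K.*-congʳ {g} (Embedding.emb-step embeddingS f))
    (K.trans (K.distribʳ g (const (f 0)) (S ⊗ embS (f ∘ suc)))
             (K.+-cong (const-⊗ (f 0) g) (K.*-assoc S (embS (f ∘ suc)) g))) n i j) (line i)
    where
    line : ∀ i → f 0 * g n i j + (S ⊗ (embS (f ∘ suc) ⊗ g)) n i j ≈ f i * g n 0 j
    line zero    = trans (+-congˡ (S-⊗-zero (embS (f ∘ suc) ⊗ g) n j)) (+-identityʳ _)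
    line (suc i) = trans (+-cong (trans (*-congˡ (h n i j)) (zeroʳ _)) (S-⊗-suc (embS (f ∘ suc) ⊗ g) n i j))
                         (trans (+-identityˡ _) (embS-⊗ (f ∘ suc) g h n i j))

  embT-off : ∀ g n i j → embT g n (suc i) j ≈ 0#
  embT-off g zero    i j = refl
  embT-off g (suc n) i j = refl

  embS-⊗-embT : ∀ f g i j → (embS f ⊗ embT g) 0 i j ≈ f i * g j
  embS-⊗-embT f g i j = embS-⊗ f (embT g) (embT-off g) 0 i j

  embS-⊗-embT-suc : ∀ f g n i j → (embS f ⊗ embT g) (suc n) i j ≈ 0#
  embS-⊗-embT-suc f g n i j = trans (embS-⊗ f (embT g) (embT-off g) (suc n) i j) (zeroʳ _)

-- Permutations, words and compatible sequences

module Combinatorics where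
  open ≡ using (refl; sym; trans)

  odd : ℕ → Bool
  odd zero    = false
  odd (suc n) = not (odd n)

  -- The order isomorphism from ℕ to ℕ ∖ {p}.
  skip : ℕ → ℕ → ℕ
  skip zero    x       = suc x
  skip (suc p) zero    = zero
  skip (suc p) (suc x) = suc (skip p x)

  skip-<ᵇ : ∀ p x y → (skip p x <ᵇ skip p y) ≡ (x <ᵇ y)
  skip-<ᵇ zero    x       y       = refl
  skip-<ᵇ (suc p) zero    zero    = refl
  skip-<ᵇ (suc p) zero    (suc y) = refl
  skip-<ᵇ (suc p) (suc x) zero    = refl
  skip-<ᵇ (suc p) (suc x) (suc y) = skip-<ᵇ p x y

  skip-≡ᵇ : ∀ p x y → (skip p x ≡ᵇ skip p y) ≡ (x ≡ᵇ y)
  skip-≡ᵇ zero    x       y       = refl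
  skip-≡ᵇ (suc p) zero    zero    = refl
  skip-≡ᵇ (suc p) zero    (suc y) = refl
  skip-≡ᵇ (suc p) (suc x) zero    = refl
  skip-≡ᵇ (suc p) (suc x) (suc y) = skip-≡ᵇ p x y

  skip-<ᵇ-self : ∀ p x → (skip p x <ᵇ p) ≡ (x <ᵇ p)
  skip-<ᵇ-self zero    x       = refl
  skip-<ᵇ-self (suc p) zero    = refl
  skip-<ᵇ-self (suc p) (suc x) = skip-<ᵇ-self p x

  skip-≢ : ∀ p x → p ≢ skip p x
  skip-≢ zero    x       ()
  skip-≢ (suc p) zero    ()
  skip-≢ (suc p) (suc x) e = skip-≢ p x (ℕₚ.suc-injective e)

  skip-injective : ∀ p {x y} → skip p x ≡ skip p y → x ≡ y
  skip-injective zero    e = ℕₚ.suc-injective e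
  skip-injective (suc p) {zero}  {zero}  e = refl
  skip-injective (suc p) {suc x} {suc y} e = cong suc (skip-injective p (ℕₚ.suc-injective e))

  ≡ᵇ-refl : ∀ n → (n ≡ᵇ n) ≡ true
  ≡ᵇ-refl zero    = refl
  ≡ᵇ-refl (suc n) = ≡ᵇ-refl n

  ≢⇒≡ᵇ-false : ∀ {m n} → m ≢ n → (m ≡ᵇ n) ≡ false
  ≢⇒≡ᵇ-false {zero}  {zero}  h = contradiction refl h
  ≢⇒≡ᵇ-false {zero}  {suc n} h = refl
  ≢⇒≡ᵇ-false {suc m} {zero}  h = refl
  ≢⇒≡ᵇ-false {suc m} {suc n} h = ≢⇒≡ᵇ-false (h ∘ cong suc)

  -- The final flag is set to false, as if the word were followed by ∞.
  descents : ∀ {n} → Vec ℕ n → Vec Bool n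
  descents []          = []
  descents (a ∷ [])    = false ∷ []
  descents (a ∷ b ∷ w) = (b <ᵇ a) ∷ descents (b ∷ w)

  descents-map : ∀ (f : ℕ → ℕ) → (∀ x y → (f x <ᵇ f y) ≡ (x <ᵇ y)) →
    ∀ {n} (w : Vec ℕ n) → descents (Vec.map f w) ≡ descents w
  descents-map f h []          = refl
  descents-map f h (a ∷ [])    = refl
  descents-map f h (a ∷ b ∷ w) = cong₂ _∷_ (h b a) (descents-map f h (b ∷ w))

  -- A new minimum is followed by an ascent and, unless it comes first, preceded by a descent: the
  -- flag of its left neighbour is overwritten. Thanks to the closing `false`, insertion at the end
  -- is no special case.
  insertFlags : ∀ {n} → Fin (suc n) → Vec Bool n → Vec Bool (suc n)
  insertFlags zero          δ       = false ∷ δ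
  insertFlags (suc zero)    (ε ∷ δ) = true ∷ false ∷ δ
  insertFlags (suc (suc p)) (ε ∷ δ) = ε ∷ insertFlags (suc p) δ

  insertMin : ∀ {n} → Fin (suc n) → Vec ℕ n → Vec ℕ (suc n)
  insertMin p σ = insertAt (Vec.map suc σ) p 0

  descents-insertMin : ∀ {n} (p : Fin (suc n)) (σ : Vec ℕ n) →
    descents (insertMin p σ) ≡ insertFlags p (descents σ)
  descents-insertMin zero          []          = refl
  descents-insertMin zero          (s ∷ σ)     = cong (false ∷_) (descents-map suc (λ _ _ → refl) (s ∷ σ))
  descents-insertMin (suc zero)    (s ∷ [])    = refl
  descents-insertMin (suc zero)    (s ∷ t ∷ σ) =
    cong (λ δ → true ∷ false ∷ δ) (descents-map suc (λ _ _ → refl) (t ∷ σ))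
  descents-insertMin (suc (suc p)) (s ∷ t ∷ σ) = cong ((t <ᵇ s) ∷_) (descents-insertMin (suc p) (t ∷ σ))

  -- Strict upper bound for the letter following c across the flag ε: c itself may
  -- be repeated exactly if ε ≡ odd c.
  next : Bool → ℕ → ℕ
  next ε c = if ε xor odd c then c else suc c

  next-≥ : ∀ ε c → c ≤ next ε c
  next-≥ ε c with ε xor odd c
  ... | true  = ℕₚ.≤-refl
  ... | false = ℕₚ.n≤1+n c

  next-≤ : ∀ ε c → next ε c ≤ suc c
  next-≤ ε c with ε xor odd c
  ... | true  = ℕₚ.n≤1+n c
  ... | false = ℕₚ.≤-refl

  next-mono : ∀ ε {c d} → c ≤ d → next ε c ≤ next ε d
  next-mono ε {c} {d} c≤d with ℕₚ.m≤n⇒m<n∨m≡n c≤d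
  ... | inj₁ c<d  = ℕₚ.≤-trans (next-≤ ε c) (ℕₚ.≤-trans c<d (next-≥ ε d))
  ... | inj₂ refl = ℕₚ.≤-refl

  -- Together with `next-comp-≮` this makes `a < next true c` and `c < next false a` complementary:
  -- either `c` may precede `a` across a descent, or `a` may precede `c` across an ascent, never
  -- both. Hence an inserted letter has only one possible place.
  next-comp-< : ∀ a c → a < next true c → next false a ≤ c
  next-comp-< a c h with ℕₚ.<-cmp a c
  ... | tri< a<c _ _  = ℕₚ.≤-trans (next-≤ false a) a<c
  ... | tri> _ _ c<a  = contradiction (ℕₚ.≤-trans h (next-≤ true c)) (ℕₚ.<⇒≱ (s≤s c<a))
  ... | tri≈ _ refl _ with odd a
  ...   | true  = ℕₚ.≤-refl
  ...   | false = contradiction h (ℕₚ.<-irrefl refl)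

  next-comp-≮ : ∀ a c → ¬ (a < next true c) → c < next false a
  next-comp-≮ a c h with ℕₚ.<-cmp a c
  ... | tri< a<c _ _  = contradiction (ℕₚ.≤-trans a<c (next-≥ true c)) h
  ... | tri> _ _ c<a  = ℕₚ.≤-trans c<a (next-≥ false a)
  ... | tri≈ _ refl _ with odd a
  ...   | true  = contradiction ℕₚ.≤-refl h
  ...   | false = ℕₚ.≤-refl

  Compatible : ∀ {n} → ℕ → Vec Bool n → Vec ℕ n → Set
  Compatible u []      []       = ⊤
  Compatible u (ε ∷ δ) (c ∷ cs) = c < u × Compatible (next ε c) δ cs

  compatible? : ∀ {n} u (δ : Vec Bool n) (c : Vec ℕ n) → Dec (Compatible u δ c)
  compatible? u []      []       = yes tt
  compatible? u (ε ∷ δ) (c ∷ cs) = (c <? u) ×-dec compatible? (next ε c) δ cs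

  compatible-≤ : ∀ {n u v} (δ : Vec Bool n) c → u ≤ v → Compatible u δ c → Compatible v δ c
  compatible-≤ []      []       u≤v h         = tt
  compatible-≤ (ε ∷ δ) (c ∷ cs) u≤v (c<u , h) = ℕₚ.≤-trans c<u u≤v , h

  -- Where a new first letter of the word goes in the sorted word: after the
  -- larger letters, and after the equal letters exactly if it is odd.
  position : ∀ {n} → ℕ → Vec ℕ n → Fin (suc n)
  position a []       = zero
  position a (c ∷ cs) = if does (a <? next true c) then suc (position a cs) else zero

  position-suc : ∀ {n} a c (cs : Vec ℕ n) → a < next true c → position a (c ∷ cs) ≡ suc (position a cs)
  position-suc a c cs h rewrite dec-true (a <? next true c) h = refl

  position-zero : ∀ {n} a c (cs : Vec ℕ n) → ¬ (a < next true c) → position a (c ∷ cs) ≡ zero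
  position-zero a c cs h rewrite dec-false (a <? next true c) h = refl

  position-suc⁻¹ : ∀ {n p} a c (cs : Vec ℕ n) → suc p ≡ position a (c ∷ cs) → a < next true c
  position-suc⁻¹ a c cs e with a <? next true c
  ... | yes h = h
  ... | no h  = contradiction (trans e (position-zero a c cs h)) λ ()

  compatible⇒position-zero : ∀ {n} a (δ : Vec Bool n) c → Compatible (next false a) δ c → zero ≡ position a c
  compatible⇒position-zero a []      []       h       = refl
  compatible⇒position-zero a (ε ∷ δ) (c ∷ cs) (h , _) =
    sym (position-zero a c cs λ h′ → ℕₚ.<⇒≱ h (next-comp-< a c h′))

  position-zero⇒compatible : ∀ {n u} a (δ : Vec Bool n) c → zero ≡ position a c →
    Compatible u δ c → Compatible (next false a) δ c
  position-zero⇒compatible a []      []       e h = tt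
  position-zero⇒compatible a (ε ∷ δ) (c ∷ cs) e (_ , h) =
    next-comp-≮ a c (λ h′ → contradiction (trans e (position-suc a c cs h′)) λ ()) , h

  -- The descent before `a` says that the left neighbour lets `a` pass, the ascent after it that the
  -- right neighbour does not; this determines `position a c`. Removing `a` keeps compatibility
  -- whatever flag had been overwritten, because `next false a ≤ c ≤ next ε c` for the left
  -- neighbour `c`.
  compatible-insert⁻¹ : ∀ {n} u (p : Fin (suc n)) a (δ : Vec Bool n) c →
    Compatible u (insertFlags p δ) (insertAt c p a) → Compatible u δ c × p ≡ position a c × a < u
  compatible-insert⁻¹ u zero a δ c (a<u , h) =
    compatible-≤ δ c (ℕₚ.≤-trans (next-≤ false a) a<u) h , compatible⇒position-zero a δ c h , a<u
  compatible-insert⁻¹ u (suc zero) a (ε ∷ δ) (c ∷ cs) (c<u , a<c , h) =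
    (c<u , compatible-≤ δ cs (ℕₚ.≤-trans a≤c (next-≥ ε c)) h) ,
    trans (cong suc (compatible⇒position-zero a δ cs h)) (sym (position-suc a c cs a<c)) ,
    ℕₚ.≤-<-trans (ℕₚ.≤-trans (next-≥ false a) a≤c) c<u
    where
    a≤c : next false a ≤ c
    a≤c = next-comp-< a c a<c
  compatible-insert⁻¹ u (suc (suc p)) a (ε ∷ δ@(_ ∷ _)) (c ∷ cs@(c₂ ∷ cs₂)) (c<u , h)
    with compatible-insert⁻¹ (next ε c) (suc p) a δ cs h
  ... | h′ , e , a< =
    (c<u , h′) ,
    -- The head `c` lets `a` pass because `c₂` does and `c₂ ≤ c`.
    trans (cong suc e) (sym (position-suc a c cs (ℕₚ.≤-trans (position-suc⁻¹ a c₂ cs₂ e)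
      (next-mono true (ℕₚ.≤-pred (ℕₚ.≤-trans (proj₁ h′) (next-≤ ε c))))))) ,
    ℕₚ.≤-trans a< (ℕₚ.≤-trans (next-≤ ε c) c<u)

  compatible-insert : ∀ {n} u (p : Fin (suc n)) a (δ : Vec Bool n) c →
    Compatible u δ c × p ≡ position a c × a < u → Compatible u (insertFlags p δ) (insertAt c p a)
  compatible-insert u zero a δ c (h , e , a<u) = a<u , position-zero⇒compatible a δ c e h
  compatible-insert u (suc p) a (ε ∷ δ) (c ∷ cs) ((c<u , h) , e , a<u) =
    go p δ cs h (Finₚ.suc-injective (trans e (position-suc a c cs a<c)))
    where
    a<c : a < next true c
    a<c = position-suc⁻¹ a c cs e
    go : ∀ {m} (p : Fin (suc m)) (δ : Vec Bool m) cs → Compatible (next ε c) δ cs → p ≡ position a cs →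
      Compatible u (insertFlags (suc p) (ε ∷ δ)) (c ∷ insertAt cs p a)
    go zero    δ       cs        h e = c<u , a<c , position-zero⇒compatible a δ cs e h
    go (suc p) (ε₂ ∷ δ) (c₂ ∷ cs) h e =
      c<u , compatible-insert (next ε c) (suc p) a (ε₂ ∷ δ) (c₂ ∷ cs) (h , e ,
        ℕₚ.≤-<-trans (ℕₚ.≤-trans (next-≥ false a) (next-comp-< a c₂ (position-suc⁻¹ a c₂ cs e))) (proj₁ h))

  -- b is recovered as (sortWord b) ∘ (standardize b).
  sortWord : ∀ {n} → Vec ℕ n → Vec ℕ n
  sortWord []      = []
  sortWord (a ∷ b) = insertAt (sortWord b) (position a (sortWord b)) a

  prepend : ∀ {n} → Fin (suc n) → Vec ℕ n → Vec ℕ (suc n)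
  prepend p π = toℕ p ∷ Vec.map (skip (toℕ p)) π

  standardize : ∀ {n} → Vec ℕ n → Vec ℕ n
  standardize []      = []
  standardize (a ∷ b) = prepend (position a (sortWord b)) (standardize b)

  -- Between equal letters the standardization descends exactly if they are odd, odd ties being
  -- numbered from right to left. A larger code on the right is also a descent, since sorted words
  -- decrease.
  headFlag : ∀ {n} → ℕ → Vec ℕ n → Bool
  headFlag a []      = false
  headFlag a (b ∷ w) = does (a <? next true b)

  wordDescents : ∀ {n} → Vec ℕ n → Vec Bool n
  wordDescents []      = []
  wordDescents (a ∷ w) = headFlag a w ∷ wordDescents w

  -- These are the ranks of the first two letters of a word. In the sorted word `a` moves beyond `b`
  -- exactly if it passes the test against `b`, provided that it reaches `b` at all.
  position-insertAt : ∀ {n} a b (c : Vec ℕ n) →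
    (toℕ (position b c) <ᵇ toℕ (position a (insertAt c (position b c) b))) ≡ does (a <? next true b)
  position-insertAt a b c = go c
    where
    head : ∀ {m} (cs : Vec ℕ m) → (0 <ᵇ toℕ (position a (b ∷ cs))) ≡ does (a <? next true b)
    head cs with does (a <? next true b)
    ... | true  = refl
    ... | false = refl
    go : ∀ {m} (c : Vec ℕ m) →
      (toℕ (position b c) <ᵇ toℕ (position a (insertAt c (position b c) b))) ≡ does (a <? next true b)
    go []       = head []
    go {suc m} (c ∷ cs) with b <? next true c
    ... | no h  = subst Goal (sym (position-zero b c cs h)) (head (c ∷ cs))
      where
      Goal : Fin (suc (suc m)) → Set
      Goal p = (toℕ p <ᵇ toℕ (position a (insertAt (c ∷ cs) p b))) ≡ does (a <? next true b)
    ... | yes h = subst Goal (sym (position-suc b c cs h)) (tail (a <? next true c))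
      where
      Goal : Fin (suc (suc m)) → Set
      Goal p = (toℕ p <ᵇ toℕ (position a (insertAt (c ∷ cs) p b))) ≡ does (a <? next true b)
      cs′ = insertAt cs (position b cs) b
      tail : Dec (a < next true c) →
        (suc (toℕ (position b cs)) <ᵇ toℕ (position a (c ∷ cs′))) ≡ does (a <? next true b)
      tail (yes h′) = trans (cong (λ p → suc (toℕ (position b cs)) <ᵇ toℕ p) (position-suc a c cs′ h′)) (go cs)
      -- Here `b` passes `c` and `a` does not. Then `a` cannot pass `b` either, as `b ≤ c` and
      -- `next true` is monotone.
      tail (no h′)  = trans (cong (λ p → suc (toℕ (position b cs)) <ᵇ toℕ p) (position-zero a c cs′ h′))
        (sym (dec-false (a <? next true b) λ h″ → h′ (ℕₚ.≤-trans h″ (next-mono true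
          (ℕₚ.≤-trans (next-≥ false b) (next-comp-< b c h))))))

  descents-standardize : ∀ {n} (b : Vec ℕ n) → descents (standardize b) ≡ wordDescents b
  descents-standardize []          = refl
  descents-standardize (a ∷ [])    = refl
  descents-standardize (a ∷ b ∷ w) = cong₂ _∷_
    (trans (skip-<ᵇ-self (toℕ p) _) (position-insertAt a b (sortWord w)))
    (trans (descents-map (skip (toℕ p)) (skip-<ᵇ (toℕ p)) (standardize (b ∷ w))) (descents-standardize (b ∷ w)))
    where
    p = position a (sortWord (b ∷ w))

  -- The consequence of injectivity that left peaks require: a step that is not a descent is an
  -- ascent. It survives both `prepend` and `insertMin`.
  AdjacentDistinct : ∀ {n} → Vec ℕ n → Set
  AdjacentDistinct []          = ⊤
  AdjacentDistinct (a ∷ [])    = ⊤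
  AdjacentDistinct (a ∷ b ∷ w) = a ≢ b × AdjacentDistinct (b ∷ w)

  adjacentDistinct-map : ∀ (f : ℕ → ℕ) → (∀ {x y} → f x ≡ f y → x ≡ y) →
    ∀ {n} (w : Vec ℕ n) → AdjacentDistinct w → AdjacentDistinct (Vec.map f w)
  adjacentDistinct-map f inj []          h       = tt
  adjacentDistinct-map f inj (a ∷ [])    h       = tt
  adjacentDistinct-map f inj (a ∷ b ∷ w) (h , r) = h ∘ inj , adjacentDistinct-map f inj (b ∷ w) r

  adjacentDistinct-prepend : ∀ {n} (p : Fin (suc n)) (π : Vec ℕ n) →
    AdjacentDistinct π → AdjacentDistinct (prepend p π)
  adjacentDistinct-prepend p []      h = tt
  adjacentDistinct-prepend p (a ∷ π) h =
    skip-≢ (toℕ p) a , adjacentDistinct-map (skip (toℕ p)) (skip-injective (toℕ p)) (a ∷ π) h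

  adjacentDistinct-insertMin : ∀ {n} (p : Fin (suc n)) (σ : Vec ℕ n) →
    AdjacentDistinct σ → AdjacentDistinct (insertMin p σ)
  adjacentDistinct-insertMin zero          []          h       = tt
  adjacentDistinct-insertMin zero          (s ∷ σ)     h       =
    (λ ()) , adjacentDistinct-map suc ℕₚ.suc-injective (s ∷ σ) h
  adjacentDistinct-insertMin (suc zero)    (s ∷ [])    h       = (λ ()) , tt
  adjacentDistinct-insertMin (suc zero)    (s ∷ t ∷ σ) (_ , h) =
    (λ ()) , (λ ()) , adjacentDistinct-map suc ℕₚ.suc-injective (t ∷ σ) h
  adjacentDistinct-insertMin (suc (suc p)) (s ∷ t ∷ σ) (h , r) =
    h ∘ ℕₚ.suc-injective , adjacentDistinct-insertMin (suc p) (t ∷ σ) r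

  indexOf-map-skip : ∀ p j w → indexOf (skip p j) (List.map (skip p) w) ≡ indexOf j w
  indexOf-map-skip p j List.[]      = refl
  indexOf-map-skip p j (a List.∷ w) rewrite skip-≡ᵇ p a j | indexOf-map-skip p j w = refl

  applyUpTo-insertAt : ∀ {A : Set} (f : ℕ → A) {n} (p : Fin (suc n)) (v : Vec A n) →
    toList v ≡ List.applyUpTo (f ∘ skip (toℕ p)) n →
    toList (insertAt v p (f (toℕ p))) ≡ List.applyUpTo f (suc n)
  applyUpTo-insertAt f zero    v       e = cong (f 0 List.∷_) e
  applyUpTo-insertAt f (suc p) (x ∷ v) e =
    cong₂ List._∷_ (Listₚ.∷-injectiveˡ e) (applyUpTo-insertAt (f ∘ suc) p v (Listₚ.∷-injectiveʳ e))

  applyUpTo-cong : ∀ {A : Set} {f g : ℕ → A} → (∀ k → f k ≡ g k) → ∀ n → List.applyUpTo f n ≡ List.applyUpTo g n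
  applyUpTo-cong h zero    = refl
  applyUpTo-cong h (suc n) = cong₂ List._∷_ (h 0) (applyUpTo-cong (h ∘ suc) n)

  -- The value `p` now sits at place 0, so the inverse sends `p` to 0; each old value `j` has become
  -- `skip p j` and stands one place further right.
  inverse-prepend : ∀ {n} (p : Fin (suc n)) (π σ : Vec ℕ n) → toList σ ≡ inverse n (toList π) →
    toList (insertMin p σ) ≡ inverse (suc n) (toList (prepend p π))
  inverse-prepend {n} p π σ e = begin
    toList (insertAt (Vec.map suc σ) p 0)
      ≡⟨ cong (λ k → toList (insertAt (Vec.map suc σ) p k)) (sym at-p) ⟩
    toList (insertAt (Vec.map suc σ) p (f (toℕ p)))
      ≡⟨ applyUpTo-insertAt f p (Vec.map suc σ) below ⟩
    List.applyUpTo f (suc n)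
      ≡⟨ Listₚ.map-upTo f (suc n) ⟨
    inverse (suc n) (toList (prepend p π)) ∎
    where
    open ≡.≡-Reasoning
    f : ℕ → ℕ
    f j = indexOf j (toList (prepend p π))
    at-p : f (toℕ p) ≡ 0
    at-p rewrite ≡ᵇ-refl (toℕ p) = refl
    at-skip : ∀ j → suc (indexOf j (toList π)) ≡ f (skip (toℕ p) j)
    at-skip j rewrite ≢⇒≡ᵇ-false (skip-≢ (toℕ p) j) | Vecₚ.toList-map (skip (toℕ p)) π
                    | indexOf-map-skip (toℕ p) j (toList π) = refl
    below : toList (Vec.map suc σ) ≡ List.applyUpTo (f ∘ skip (toℕ p)) n
    below = begin
      toList (Vec.map suc σ)                                    ≡⟨ Vecₚ.toList-map suc σ ⟩
      List.map suc (toList σ)                                   ≡⟨ cong (List.map suc) e ⟩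
      List.map suc (List.map (λ j → indexOf j (toList π)) (List.upTo n))
        ≡⟨ cong (List.map suc) (Listₚ.map-upTo _ n) ⟩
      List.map suc (List.applyUpTo (λ j → indexOf j (toList π)) n) ≡⟨ Listₚ.map-applyUpTo _ suc n ⟩
      List.applyUpTo (λ j → suc (indexOf j (toList π))) n       ≡⟨ applyUpTo-cong at-skip n ⟩
      List.applyUpTo (f ∘ skip (toℕ p)) n                       ∎

  double : ℕ → ℕ
  double zero    = zero
  double (suc n) = suc (suc (double n))

  odd-double : ∀ n → odd (double n) ≡ false
  odd-double zero    = refl
  odd-double (suc n) rewrite odd-double n = refl

  odd-double-∸ : ∀ n k → k ≤ double n → odd (double n ℕ.∸ k) ≡ odd k
  odd-double-∸ n       zero          h = odd-double n
  odd-double-∸ (suc n) (suc zero)    h rewrite odd-double n = refl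
  odd-double-∸ (suc n) (suc (suc k)) (s≤s (s≤s h)) rewrite odd-double-∸ n k h = sym (not-involutive (odd k))

-- Left peaks and descents in terms of descent runs

open Combinatorics

-- The argument `ε₀` is the flag in front of the sequence. The value `false` acts like a smaller
-- entry before the permutation, which turns a descent at the first place into a left peak; `true`
-- means that a run is already under way.
starts conts : ∀ {n} → Bool → Vec Bool n → ℕ
starts ε₀ []      = 0
starts ε₀ (ε ∷ δ) = b2n (not ε₀ ∧ ε) ℕ.+ starts ε δ
conts  ε₀ []      = 0
conts  ε₀ (ε ∷ δ) = b2n (ε₀ ∧ ε) ℕ.+ conts ε δ

des≡starts+conts : ∀ {n} ε₀ (w : Vec ℕ n) → des (toList w) ≡ starts ε₀ (descents w) ℕ.+ conts ε₀ (descents w)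
des≡starts+conts ε₀ []          = ≡.refl
des≡starts+conts ε₀ (a ∷ [])    = ≡.sym (cong₂ ℕ._+_ (zero-flag (not ε₀)) (zero-flag ε₀))
  where
  zero-flag : ∀ b → b2n (b ∧ false) ℕ.+ 0 ≡ 0
  zero-flag true  = ≡.refl
  zero-flag false = ≡.refl
des≡starts+conts ε₀ (a ∷ b ∷ w) with b <ᵇ a | ε₀ | des≡starts+conts (b <ᵇ a) (b ∷ w)
... | false | true  | ih = ih
... | false | false | ih = ih
... | true  | false | ih = cong suc ih
... | true  | true  | ih = ≡.trans (cong suc ih) (≡.sym (ℕₚ.+-suc _ _))

<ᵇ-flip : ∀ {a b} → a ≢ b → (a <ᵇ b) ≡ not (b <ᵇ a)
<ᵇ-flip {zero}  {zero}  h = contradiction ≡.refl h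
<ᵇ-flip {zero}  {suc b} h = ≡.refl
<ᵇ-flip {suc a} {zero}  h = ≡.refl
<ᵇ-flip {suc a} {suc b} h = <ᵇ-flip (h ∘ cong suc)

-- A peak at `b` is a descent whose preceding step is not a descent, hence the beginning of a run.
pk≡starts : ∀ {n} a b (w : Vec ℕ n) → AdjacentDistinct (a ∷ b ∷ w) →
  pk (toList (a ∷ b ∷ w)) ≡ starts (b <ᵇ a) (descents (b ∷ w))
pk≡starts a b [] h with b <ᵇ a
... | true  = ≡.refl
... | false = ≡.refl
pk≡starts a b (c ∷ w) (a≢b , h) =
  cong₂ ℕ._+_ (cong (λ t → b2n (t ∧ (c <ᵇ b))) (<ᵇ-flip a≢b)) (pk≡starts b c w h)

lpk≡starts : ∀ {n} (w : Vec ℕ n) → AdjacentDistinct w → lpk (toList w) ≡ starts false (descents w)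
lpk≡starts []          h = ≡.refl
lpk≡starts (a ∷ [])    h = ≡.refl
lpk≡starts (a ∷ b ∷ w) h = cong (b2n (b <ᵇ a) ℕ.+_) (pk≡starts a b w h)

double≡2* : ∀ n → double n ≡ 2 ℕ.* n
double≡2* zero    = ≡.refl
double≡2* (suc n) = cong suc (≡.trans (cong suc (double≡2* n)) (≡.sym (ℕₚ.+-suc n (n ℕ.+ 0))))


-- Finite sums over words and permutations

module FiniteSums {c ℓ : Level} (R : CommutativeRing c ℓ) where
  open CommutativeRing R hiding (zero)
  open Series R using (sumList)
  open CommutativeSemigroupProperties +-commutativeSemigroup using (interchange)
  open SetoidReasoning setoid

  -- The sums `∑`, `∑F`, `ΣW` and `ΣP` are all of this kind, so `Φ-∑` and `Φ-∑F` cover the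
  -- interchanges of summation.
  record Linear {A : Set} (Φ : (A → Carrier) → Carrier) : Set (c ⊔ ℓ) where
    field
      Φ-cong : ∀ {f g} → (∀ x → f x ≈ g x) → Φ f ≈ Φ g
      Φ-+    : ∀ f g → Φ (λ x → f x + g x) ≈ Φ f + Φ g
      Φ-*    : ∀ k f → Φ (λ x → k * f x) ≈ k * Φ f

    Φ-0 : Φ (λ _ → 0#) ≈ 0#
    Φ-0 = trans (Φ-cong λ _ → sym (zeroˡ 0#)) (trans (Φ-* 0# _) (zeroˡ _))

  open Linear

  when : Bool → Carrier → Carrier
  when true  x = x
  when false x = 0#

  when-cong : ∀ b {x y} → x ≈ y → when b x ≈ when b y
  when-cong true  e = e
  when-cong false e = refl

  when-* : ∀ b x y → x * when b y ≈ when b (x * y)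
  when-* true  x y = refl
  when-* false x y = zeroʳ x

  when-∧ : ∀ b b′ x → when (b ∧ b′) x ≈ when b (when b′ x)
  when-∧ true  b′ x = refl
  when-∧ false b′ x = refl

  Φ-when : ∀ {A} {Φ : (A → Carrier) → Carrier} → Linear Φ → ∀ b f → Φ (λ x → when b (f x)) ≈ when b (Φ f)
  Φ-when L true  f = refl
  Φ-when L false f = Φ-0 L

  ∑ : ℕ → (ℕ → Carrier) → Carrier
  ∑ zero    f = 0#
  ∑ (suc n) f = ∑ n f + f n

  ∑-cong-< : ∀ n {f g} → (∀ k → k < n → f k ≈ g k) → ∑ n f ≈ ∑ n g
  ∑-cong-< zero    h = refl
  ∑-cong-< (suc n) h = +-cong (∑-cong-< n λ k k<n → h k (ℕₚ.m<n⇒m<1+n k<n)) (h n ℕₚ.≤-refl)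

  ∑-linear : ∀ n → Linear (∑ n)
  ∑-linear n = record { Φ-cong = λ h → ∑-cong-< n λ k _ → h k ; Φ-+ = add n ; Φ-* = scale n }
    where
    add : ∀ n f g → ∑ n (λ x → f x + g x) ≈ ∑ n f + ∑ n g
    add zero    f g = sym (+-identityˡ 0#)
    add (suc n) f g = trans (+-congʳ (add n f g)) (interchange _ _ _ _)
    scale : ∀ n k f → ∑ n (λ x → k * f x) ≈ k * ∑ n f
    scale zero    k f = sym (zeroʳ k)
    scale (suc n) k f = trans (+-congʳ (scale n k f)) (sym (distribˡ k _ _))

  ∑-first : ∀ n f → ∑ (suc n) f ≈ f 0 + ∑ n (f ∘ suc)
  ∑-first zero    f = +-comm _ _
  ∑-first (suc n) f = trans (+-congʳ (∑-first n f)) (+-assoc _ _ _)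

  ∑-below : ∀ n u f → u ≤ n → ∑ n (λ k → when (does (k <? u)) (f k)) ≈ ∑ u f
  ∑-below zero    zero f u≤n = refl
  ∑-below (suc n) u    f u≤n with u ℕ.≟ suc n
  ... | yes ≡.refl = ∑-cong-< (suc n) λ k k<n → reflexive (cong (λ b → when b (f k)) (dec-true (k <? suc n) k<n))
  ... | no u≢      = trans (+-cong (∑-below n u f u≤n′)
    (reflexive (cong (λ b → when b (f n)) (dec-false (n <? u) (ℕₚ.≤⇒≯ u≤n′))))) (+-identityʳ _)
    where u≤n′ = ℕₚ.≤-pred (ℕₚ.≤∧≢⇒< u≤n u≢)

  Φ-∑ : ∀ {A} {Φ : (A → Carrier) → Carrier} → Linear Φ → ∀ n (f : A → ℕ → Carrier) →
    Φ (λ x → ∑ n (f x)) ≈ ∑ n (λ k → Φ (λ x → f x k))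
  Φ-∑ L zero    f = Φ-0 L
  Φ-∑ L (suc n) f = trans (Φ-+ L _ _) (+-congʳ (Φ-∑ L n f))

  opaque
    ∑F : ∀ n → (Fin n → Carrier) → Carrier
    ∑F zero    f = 0#
    ∑F (suc n) f = f zero + ∑F n (f ∘ suc)

    ∑F-linear : ∀ n → Linear (∑F n)
    ∑F-linear n = record { Φ-cong = congF n ; Φ-+ = add n ; Φ-* = scale n }
      where
      congF : ∀ n {f g} → (∀ x → f x ≈ g x) → ∑F n f ≈ ∑F n g
      congF zero    h = refl
      congF (suc n) h = +-cong (h zero) (congF n (h ∘ suc))
      add : ∀ n f g → ∑F n (λ x → f x + g x) ≈ ∑F n f + ∑F n g
      add zero    f g = sym (+-identityˡ 0#)
      add (suc n) f g = trans (+-congˡ (add n _ _)) (interchange _ _ _ _)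
      scale : ∀ n k f → ∑F n (λ x → k * f x) ≈ k * ∑F n f
      scale zero    k f = sym (zeroʳ k)
      scale (suc n) k f = trans (+-congˡ (scale n k _)) (sym (distribˡ k _ _))

    Φ-∑F : ∀ {A} {Φ : (A → Carrier) → Carrier} → Linear Φ → ∀ n (f : A → Fin n → Carrier) →
      Φ (λ x → ∑F n (f x)) ≈ ∑F n (λ k → Φ (λ x → f x k))
    Φ-∑F L zero    f = Φ-0 L
    Φ-∑F L (suc n) f = trans (Φ-+ L _ _) (+-congˡ (Φ-∑F L n (λ x → f x ∘ suc)))

    ∑≈∑F : ∀ n f → ∑ n f ≈ ∑F n (f ∘ toℕ)
    ∑≈∑F zero    f = refl
    ∑≈∑F (suc n) f = trans (∑-first n f) (+-congˡ (∑≈∑F n (f ∘ suc)))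

    ∑F-single : ∀ n k (f : Fin n → Carrier) → ∑F n (λ p → when (does (p Finₚ.≟ k)) (f p)) ≈ f k
    ∑F-single (suc n) zero    f = trans (+-congˡ (Φ-0 (∑F-linear n))) (+-identityʳ _)
    ∑F-single (suc n) (suc k) f = trans (+-identityˡ _) (∑F-single n k (f ∘ suc))

  ΣW : ∀ q n → (Vec ℕ n → Carrier) → Carrier
  ΣW q zero    f = f []
  ΣW q (suc n) f = ∑ q λ a → ΣW q n λ w → f (a ∷ w)

  ΣW-linear : ∀ q n → Linear (ΣW q n)
  ΣW-linear q zero    = record { Φ-cong = λ h → h [] ; Φ-+ = λ _ _ → refl ; Φ-* = λ _ _ → refl }
  ΣW-linear q (suc n) = record
    { Φ-cong = λ h → Φ-cong ∑L λ a → Φ-cong WL λ w → h (a ∷ w)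
    ; Φ-+    = λ f g → trans (Φ-cong ∑L λ a → Φ-+ WL _ _) (Φ-+ ∑L _ _)
    ; Φ-*    = λ k f → trans (Φ-cong ∑L λ a → Φ-* WL k _) (Φ-* ∑L k _)
    }
    where
    ∑L = ∑-linear q
    WL = ΣW-linear q n

  ΣW-insertAt : ∀ q n (p : Fin (suc n)) (f : Vec ℕ (suc n) → Carrier) →
    ΣW q (suc n) f ≈ ∑ q (λ a → ΣW q n (λ w → f (insertAt w p a)))
  ΣW-insertAt q n       zero    f = refl
  ΣW-insertAt q (suc n) (suc p) f = begin
    ∑ q (λ b → ΣW q (suc n) (λ w → f (b ∷ w)))
      ≈⟨ Φ-cong (∑-linear q) (λ b → ΣW-insertAt q n p (λ w → f (b ∷ w))) ⟩
    ∑ q (λ b → ∑ q (λ a → ΣW q n (λ w → f (b ∷ insertAt w p a))))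
      ≈⟨ Φ-∑ (∑-linear q) q _ ⟩
    ∑ q (λ a → ∑ q (λ b → ΣW q n (λ w → f (b ∷ insertAt w p a)))) ∎

  -- Sum over the pairs (π , π⁻¹), where π ranges over the permutations of
  -- {0,…,n-1}: π is its first value p followed by a smaller permutation.
  ΣP : ∀ n → (Vec ℕ n → Vec ℕ n → Carrier) → Carrier
  ΣP zero    f = f [] []
  ΣP (suc n) f = ∑F (suc n) λ p → ΣP n λ π σ → f (prepend p π) (insertMin p σ)

  InversePair : ∀ {n} → Vec ℕ n → Vec ℕ n → Set
  InversePair {n} π σ = AdjacentDistinct π × AdjacentDistinct σ × toList σ ≡ inverse n (toList π)

  ΣP-cong : ∀ n {f g} → (∀ π σ → InversePair π σ → f π σ ≈ g π σ) → ΣP n f ≈ ΣP n g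
  ΣP-cong zero    h = h [] [] (tt , tt , ≡.refl)
  ΣP-cong (suc n) h = Φ-cong (∑F-linear (suc n)) λ p → ΣP-cong n λ π σ (dπ , dσ , e) →
    h _ _ (adjacentDistinct-prepend p π dπ , adjacentDistinct-insertMin p σ dσ , inverse-prepend p π σ e)

  ΣP-linear : ∀ n → Linear (λ (f : Vec ℕ n × Vec ℕ n → Carrier) → ΣP n (λ π σ → f (π , σ)))
  ΣP-linear n = record { Φ-cong = λ h → ΣP-cong n λ π σ _ → h (π , σ) ; Φ-+ = λ f g → add n _ _ ; Φ-* = λ k f → scale n k _ }
    where
    add : ∀ n f g → ΣP n (λ π σ → f π σ + g π σ) ≈ ΣP n f + ΣP n g
    add zero    f g = refl
    add (suc n) f g = trans (Φ-cong (∑F-linear (suc n)) λ p → add n _ _) (Φ-+ (∑F-linear (suc n)) _ _)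
    scale : ∀ n k f → ΣP n (λ π σ → k * f π σ) ≈ k * ΣP n f
    scale zero    k f = refl
    scale (suc n) k f = trans (Φ-cong (∑F-linear (suc n)) λ p → scale n k _) (Φ-* (∑F-linear (suc n)) k _)

  sumList-++ : ∀ {A : Set} (f : A → Carrier) xs ys → sumList f (xs List.++ ys) ≈ sumList f xs + sumList f ys
  sumList-++ f List.[]       ys = sym (+-identityˡ _)
  sumList-++ f (x List.∷ xs) ys = trans (+-congˡ (sumList-++ f xs ys)) (sym (+-assoc _ _ _))

  sumList-cong : ∀ {A : Set} {f g : A → Carrier} → (∀ x → f x ≈ g x) → ∀ xs → sumList f xs ≈ sumList g xs
  sumList-cong h List.[]       = refl
  sumList-cong h (x List.∷ xs) = +-cong (h x) (sumList-cong h xs)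

  sumList-concatMap : ∀ {A B : Set} (f : B → Carrier) (g : A → List B) xs →
    sumList f (List.concatMap g xs) ≈ sumList (λ x → sumList f (g x)) xs
  sumList-concatMap f g List.[]       = refl
  sumList-concatMap f g (x List.∷ xs) = trans (sumList-++ f (g x) _) (+-congˡ (sumList-concatMap f g xs))

  sumList-map : ∀ {A B : Set} (f : B → Carrier) (g : A → B) xs → sumList f (List.map g xs) ≈ sumList (f ∘ g) xs
  sumList-map f g List.[]       = refl
  sumList-map f g (x List.∷ xs) = +-congˡ (sumList-map f g xs)

  sumList-filterᵇ : ∀ {A : Set} (f : A → Carrier) (P : A → Bool) xs →
    sumList f (List.filterᵇ P xs) ≈ sumList (λ x → when (P x) (f x)) xs
  sumList-filterᵇ f P List.[] = refl
  sumList-filterᵇ f P (x List.∷ xs) with P x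
  ... | true  = +-congˡ (sumList-filterᵇ f P xs)
  ... | false = trans (sumList-filterᵇ f P xs) (sym (+-identityˡ _))

  sumList-applyUpTo : ∀ {A : Set} (f : A → Carrier) (g : ℕ → A) n → sumList f (List.applyUpTo g n) ≈ ∑ n (f ∘ g)
  sumList-applyUpTo f g zero    = refl
  sumList-applyUpTo f g (suc n) = trans (+-congˡ (sumList-applyUpTo f (g ∘ suc) n)) (sym (∑-first n (f ∘ g)))

  sumList-words : ∀ q n f → sumList f (words q n) ≈ ΣW q n (f ∘ toList)
  sumList-words q zero    f = +-identityʳ _
  sumList-words q (suc n) f = begin
    sumList f (List.concatMap (λ w → List.map (List._∷ w) (List.upTo q)) (words q n))
      ≈⟨ sumList-concatMap f _ (words q n) ⟩
    sumList (λ w → sumList f (List.map (List._∷ w) (List.upTo q))) (words q n)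
      ≈⟨ sumList-cong (λ w → trans (sumList-map f (List._∷ w) (List.upTo q)) (sumList-applyUpTo _ id q)) (words q n) ⟩
    sumList (λ w → ∑ q (λ a → f (a List.∷ w))) (words q n)
      ≈⟨ sumList-words q n _ ⟩
    ΣW q n (λ w → ∑ q (λ a → f (a List.∷ toList w)))
      ≈⟨ Φ-∑ (ΣW-linear q n) q _ ⟩
    ∑ q (λ a → ΣW q n (λ w → f (a List.∷ toList w))) ∎

  ∑-skip : ∀ q p f → p ≤ q → ∑ (suc q) (λ k → when (not (p ≡ᵇ k)) (f k)) ≈ ∑ q (f ∘ skip p)
  ∑-skip q       zero    f p≤q = trans (∑-first q _) (+-identityˡ _)
  ∑-skip (suc q) (suc p) f (s≤s p≤q) = begin
    ∑ (suc (suc q)) (λ k → when (not (suc p ≡ᵇ k)) (f k))            ≈⟨ ∑-first (suc q) _ ⟩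
    f 0 + ∑ (suc q) (λ k → when (not (p ≡ᵇ k)) (f (suc k)))          ≈⟨ +-congˡ (∑-skip q p (f ∘ suc) p≤q) ⟩
    f 0 + ∑ q (f ∘ suc ∘ skip p)                                     ≈⟨ ∑-first q _ ⟨
    ∑ (suc q) (f ∘ skip (suc p))                                     ∎

  ΣW-avoid : ∀ q n p (f : Vec ℕ n → Carrier) → p ≤ q →
    ΣW (suc q) n (λ w → when (not (member p (toList w))) (f w)) ≈ ΣW q n (f ∘ Vec.map (skip p))
  ΣW-avoid q zero    p f p≤q = refl
  ΣW-avoid q (suc n) p f p≤q = begin
    ∑ (suc q) (λ a → ΣW (suc q) n (λ w → when (not (if p ≡ᵇ a then true else member p (toList w))) (f (a ∷ w))))
      ≈⟨ Φ-cong (∑-linear (suc q)) (λ a → trans (Φ-cong (ΣW-linear (suc q) n) (λ w → split (p ≡ᵇ a) _ _))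
           (trans (Φ-when (ΣW-linear (suc q) n) (not (p ≡ᵇ a)) _)
                  (when-cong (not (p ≡ᵇ a)) (ΣW-avoid q n p (λ w → f (a ∷ w)) p≤q)))) ⟩
    ∑ (suc q) (λ a → when (not (p ≡ᵇ a)) (ΣW q n (λ w → f (a ∷ Vec.map (skip p) w))))
      ≈⟨ ∑-skip q p _ p≤q ⟩
    ∑ q (λ a → ΣW q n (λ w → f (skip p a ∷ Vec.map (skip p) w))) ∎
    where
    split : ∀ b b′ x → when (not (if b then true else b′)) x ≈ when (not b) (when (not b′) x)
    split true  b′ x = refl
    split false b′ x = refl

  member-map-skip : ∀ p a {n} (w : Vec ℕ n) →
    member (skip p a) (toList (Vec.map (skip p) w)) ≡ member a (toList w)
  member-map-skip p a []      = ≡.refl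
  member-map-skip p a (b ∷ w) = cong₂ (if_then true else_) (skip-≡ᵇ p a b) (member-map-skip p a w)

  distinct-map-skip : ∀ p {n} (w : Vec ℕ n) → distinct (toList (Vec.map (skip p) w)) ≡ distinct (toList w)
  distinct-map-skip p []      = ≡.refl
  distinct-map-skip p (a ∷ w) = cong₂ (λ b b′ → not b ∧ b′) (member-map-skip p a w) (distinct-map-skip p w)

  -- Once the first value `a` is fixed, the rest is a distinct word avoiding `a`, and `skip a`
  -- identifies it with a permutation of one element fewer. This converts the filtered enumeration
  -- into the recursion of `ΣP`.
  ΣW-distinct : ∀ n (f : Vec ℕ n → Carrier) →
    ΣW n n (λ w → when (distinct (toList w)) (f w)) ≈ ΣP n (λ π σ → f π)
  ΣW-distinct zero    f = refl
  ΣW-distinct (suc n) f = begin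
    ∑ (suc n) (λ a → ΣW (suc n) n (λ w → when (not (member a (toList w)) ∧ distinct (toList w)) (f (a ∷ w))))
      ≈⟨ ∑-cong-< (suc n) (λ a a<n → begin
           ΣW (suc n) n (λ w → when (not (member a (toList w)) ∧ distinct (toList w)) (f (a ∷ w)))
             ≈⟨ Φ-cong (ΣW-linear (suc n) n) (λ w → when-∧ (not (member a (toList w))) _ _) ⟩
           ΣW (suc n) n (λ w → when (not (member a (toList w))) (when (distinct (toList w)) (f (a ∷ w))))
             ≈⟨ ΣW-avoid n n a _ (ℕₚ.≤-pred a<n) ⟩
           ΣW n n (λ w → when (distinct (toList (Vec.map (skip a) w))) (f (a ∷ Vec.map (skip a) w)))
             ≈⟨ Φ-cong (ΣW-linear n n) (λ w → reflexive (cong (λ b → when b (f (a ∷ Vec.map (skip a) w))) (distinct-map-skip a w))) ⟩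
           ΣW n n (λ w → when (distinct (toList w)) (f (a ∷ Vec.map (skip a) w)))
             ≈⟨ ΣW-distinct n (λ w → f (a ∷ Vec.map (skip a) w)) ⟩
           ΣP n (λ π σ → f (a ∷ Vec.map (skip a) π)) ∎) ⟩
    ∑ (suc n) (λ a → ΣP n (λ π σ → f (a ∷ Vec.map (skip a) π)))
      ≈⟨ ∑≈∑F (suc n) _ ⟩
    ∑F (suc n) (λ p → ΣP n (λ π σ → f (prepend p π))) ∎

  sumList-perms : ∀ n f → sumList f (perms n) ≈ ΣP n (λ π σ → f (toList π))
  sumList-perms n f = trans (sumList-filterᵇ f distinct (words n n))
    (trans (sumList-words n n _) (ΣW-distinct n (f ∘ toList)))

  -- Standardization: each word b comes from exactly one permutation π and one
  -- sequence c compatible with π⁻¹, namely standardize b and sortWord b.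
  ΣP-standardize : ∀ q n (H : Vec ℕ n → Vec ℕ n → Carrier) →
    ΣP n (λ π σ → ΣW q n (λ c → when (does (compatible? q (descents σ) c)) (H π c)))
      ≈ ΣW q n (λ b → H (standardize b) (sortWord b))
  ΣP-standardize q zero    H = refl
  ΣP-standardize q (suc n) H = begin
    ∑F (suc n) (λ p → ΣP n (λ π σ → ΣW q (suc n) (λ c →
      when (does (compatible? q (descents (insertMin p σ)) c)) (H (prepend p π) c))))
      ≈⟨ Φ-cong (∑F-linear (suc n)) (λ p → ΣP-cong n (λ π σ _ → begin
           -- The minimum of the inverse stands at place `p`, so the letter split off from `c` is
           -- the one at place `p`, not the first.
           _ ≈⟨ ΣW-insertAt q n p (λ c → when (does (compatible? q (descents (insertMin p σ)) c)) (H (prepend p π) c)) ⟩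
           _ ≈⟨ ∑-cong-< q (λ a a<q → Φ-cong (ΣW-linear q n) (λ c → trans
                  (reflexive (cong (λ b → when b (H (prepend p π) (insertAt c p a))) (insert-test p σ a c a<q)))
                  (when-∧ (does (compatible? q (descents σ) c)) _ _))) ⟩
           _ ∎)) ⟩
    ∑F (suc n) (λ p → ΣP n (λ π σ → ∑ q (λ a → ΣW q n (λ c →
      when (does (compatible? q (descents σ) c)) (H′ a p π c)))))
      ≈⟨ Φ-cong (∑F-linear (suc n)) (λ p → Φ-∑ (ΣP-linear n) q _) ⟩
    ∑F (suc n) (λ p → ∑ q (λ a → ΣP n (λ π σ → ΣW q n (λ c →
      when (does (compatible? q (descents σ) c)) (H′ a p π c)))))
      ≈⟨ Φ-∑ (∑F-linear (suc n)) q _ ⟩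
    ∑ q (λ a → ∑F (suc n) (λ p → ΣP n (λ π σ → ΣW q n (λ c →
      when (does (compatible? q (descents σ) c)) (H′ a p π c)))))
      ≈⟨ Φ-cong (∑-linear q) (λ a → Φ-cong (∑F-linear (suc n)) (λ p → ΣP-standardize q n (H′ a p))) ⟩
    ∑ q (λ a → ∑F (suc n) (λ p → ΣW q n (λ b → H′ a p (standardize b) (sortWord b))))
      ≈⟨ Φ-cong (∑-linear q) (λ a → sym (Φ-∑F (ΣW-linear q n) (suc n) _)) ⟩
    ∑ q (λ a → ΣW q n (λ b → ∑F (suc n) (λ p → H′ a p (standardize b) (sortWord b))))
      ≈⟨ Φ-cong (∑-linear q) (λ a → Φ-cong (ΣW-linear q n) (λ b →
           ∑F-single (suc n) (position a (sortWord b)) (λ p → H (prepend p (standardize b)) (insertAt (sortWord b) p a)))) ⟩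
    ∑ q (λ a → ΣW q n (λ b → H (standardize (a ∷ b)) (sortWord (a ∷ b)))) ∎
    where
    H′ : ℕ → Fin (suc n) → Vec ℕ n → Vec ℕ n → Carrier
    H′ a p π c = when (does (p Finₚ.≟ position a c)) (H (prepend p π) (insertAt c p a))
    insert-test : ∀ p σ a c → a < q → does (compatible? q (descents (insertMin p σ)) (insertAt c p a)) ≡
      does (compatible? q (descents σ) c) ∧ does (p Finₚ.≟ position a c)
    insert-test p σ a c a<q rewrite descents-insertMin p σ =
      does-⇔ (mk⇔ (λ h → let h₁ , h₂ , _ = compatible-insert⁻¹ q p a (descents σ) c h in h₁ , h₂)
                  (λ (h₁ , h₂) → compatible-insert q p a (descents σ) c (h₁ , h₂ , a<q)))
        (compatible? q (insertFlags p (descents σ)) (insertAt c p a))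
        (compatible? q (descents σ) c ×-dec (p Finₚ.≟ position a c))

-- Weighted words and sorted sequences of pairs

module Words {c ℓ : Level} (R : CommutativeRing c ℓ) where
  open CommutativeRing R hiding (zero)
  open FiniteSums R
  open Linear
  open SetoidReasoning setoid
  open SemiringSolver commutativeSemiring using (solve; _:+_; _:*_; _:=_)

  weight : Carrier → ℕ → Carrier
  weight y k = if odd k then y else 1#

  wordWeight : ∀ {n} → Carrier → Vec ℕ n → Carrier
  wordWeight y []      = 1#
  wordWeight y (b ∷ w) = weight y b * wordWeight y w

  -- The weighted number of sequences compatible with the flags δ whose letters
  -- are less than u.  For u = 2i+1 the letter k stands for ⌈i-k/2⌉, primed if k is odd,
  -- so that increasing sequences of letters decrease here.
  G : ∀ {n} → Carrier → ℕ → Vec Bool n → Carrier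
  G y u []      = 1#
  G y u (ε ∷ δ) = ∑ u λ b → weight y b * G y (next ε b) δ

  wordWeight-insertAt : ∀ y {n} (w : Vec ℕ n) p a → wordWeight y (insertAt w p a) ≈ weight y a * wordWeight y w
  wordWeight-insertAt y w       zero    a = refl
  wordWeight-insertAt y (b ∷ w) (suc p) a = trans (*-congˡ (wordWeight-insertAt y w p a))
    (solve 3 (λ x y z → x :* (y :* z) := y :* (x :* z)) refl (weight y b) (weight y a) (wordWeight y w))

  wordWeight-sortWord : ∀ y {n} (b : Vec ℕ n) → wordWeight y (sortWord b) ≈ wordWeight y b
  wordWeight-sortWord y []      = refl
  wordWeight-sortWord y (a ∷ b) = trans (wordWeight-insertAt y (sortWord b) (position a (sortWord b)) a) (*-congˡ (wordWeight-sortWord y b))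

  G-compatible : ∀ y q u {n} (δ : Vec Bool n) → u ≤ q →
    ΣW q n (λ c → when (does (compatible? u δ c)) (wordWeight y c)) ≈ G y u δ
  G-compatible y q u []              u≤q = refl
  G-compatible y q u {suc n} (ε ∷ δ) u≤q = begin
    ∑ q (λ b → ΣW q n (λ c → when (does (b <? u) ∧ does (compatible? (next ε b) δ c)) (weight y b * wordWeight y c)))
      ≈⟨ Φ-cong (∑-linear q) (λ b → trans
           (Φ-cong (ΣW-linear q n) (λ c → trans (when-∧ (does (b <? u)) _ _)
             (when-cong (does (b <? u)) (sym (when-* (does (compatible? (next ε b) δ c)) _ _)))))
           (trans (Φ-when (ΣW-linear q n) (does (b <? u)) _)
             (when-cong (does (b <? u)) (Φ-* (ΣW-linear q n) (weight y b) _)))) ⟩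
    ∑ q (λ b → when (does (b <? u)) (weight y b * ΣW q n (λ c → when (does (compatible? (next ε b) δ c)) (wordWeight y c))))
      ≈⟨ ∑-below q u _ u≤q ⟩
    ∑ u (λ b → weight y b * ΣW q n (λ c → when (does (compatible? (next ε b) δ c)) (wordWeight y c)))
      ≈⟨ ∑-cong-< u (λ b b<u → *-congˡ (G-compatible y q (next ε b) δ
           (ℕₚ.≤-trans (next-≤ ε b) (ℕₚ.≤-trans b<u u≤q)))) ⟩
    ∑ u (λ b → weight y b * G y (next ε b) δ) ∎

  -- The weight of a compatible sequence depends only on its multiset of letters, so it can be read
  -- off the word that sorts to it.
  ΣP-words : ∀ z q n (F : Vec Bool n → Carrier) →
    ΣP n (λ π σ → F (descents π) * G z q (descents σ)) ≈ ΣW q n (λ b → F (wordDescents b) * wordWeight z b)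
  ΣP-words z q n F = begin
    ΣP n (λ π σ → F (descents π) * G z q (descents σ))
      ≈⟨ ΣP-cong n (λ π σ _ → trans (*-congˡ (sym (G-compatible z q q (descents σ) ℕₚ.≤-refl)))
           (trans (sym (Φ-* (ΣW-linear q n) (F (descents π)) _))
             (Φ-cong (ΣW-linear q n) (λ c → when-* (does (compatible? q (descents σ) c)) _ _)))) ⟩
    ΣP n (λ π σ → ΣW q n (λ c → when (does (compatible? q (descents σ) c)) (F (descents π) * wordWeight z c)))
      ≈⟨ ΣP-standardize q n (λ π c → F (descents π) * wordWeight z c) ⟩
    ΣW q n (λ b → F (descents (standardize b)) * wordWeight z (sortWord b))
      ≈⟨ Φ-cong (ΣW-linear q n) (λ b → *-cong (reflexive (cong F (descents-standardize b))) (wordWeight-sortWord z b)) ⟩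
    ΣW q n (λ b → F (wordDescents b) * wordWeight z b) ∎

  -- Sequences of m pairs (letter below r, letter below 2j+1), sorted
  -- lexicographically with the second order reversed on odd first letters.
  module Pairs (y z : Carrier) (j : ℕ) where

    q : ℕ
    q = suc (double j)

    biwords : ℕ → ℕ → Carrier
    biwords r m = ΣW q m (λ b → G y r (wordDescents b) * wordWeight z b)

    -- While an odd first letter repeats, the flags are `true` and the second letters increase;
    -- reflecting them lets both cases count downwards. As `double j` is even, the reflection
    -- preserves parity and hence weights.
    order : Bool → ℕ → ℕ
    order false k = k
    order true  k = double j ℕ.∸ k

    odd-order : ∀ β k → k < q → odd (order β k) ≡ odd k
    odd-order false k k<q = ≡.refl
    odd-order true  k k<q = odd-double-∸ j k (ℕₚ.≤-pred k<q)

    after : ℕ → ℕ → ℕ → Carrier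
    after ρ b m = ΣW q m (λ w → G y (next (headFlag b w) ρ) (wordDescents w) * wordWeight z w)

    -- The first pair is restricted to first letters below ρ, or to the first letter ρ
    -- and one of the k last second letters in the order used for ρ.
    partialRow : ℕ → ℕ → ℕ → Carrier
    partialRow ρ k zero    = 1#
    partialRow ρ k (suc m) =
      biwords ρ (suc m) + weight y ρ * ∑ k (λ x → weight z (order (odd ρ) x) * after ρ (order (odd ρ) x) m)

    ∑-above : ∀ N u (φ : ℕ → Carrier) → ∑ (suc N) (λ b → when (not (does (b <? u))) (φ b)) ≈ ∑ (suc N ℕ.∸ u) (λ x → φ (N ℕ.∸ x))
    ∑-above zero    zero    φ = refl
    ∑-above zero    (suc u) φ rewrite ℕₚ.0∸n≡0 u = +-identityˡ 0#
    ∑-above (suc N) u       φ with u ℕ.≤? suc N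
    ... | yes u≤N = begin
      ∑ (suc N) (λ b → when (not (does (b <? u))) (φ b)) + when (not (does (suc N <? u))) (φ (suc N))
        ≈⟨ +-cong (∑-above N u φ) (reflexive (cong (λ b → when (not b) (φ (suc N))) (dec-false (suc N <? u) (ℕₚ.≤⇒≯ u≤N)))) ⟩
      ∑ (suc N ℕ.∸ u) (λ x → φ (N ℕ.∸ x)) + φ (suc N)            ≈⟨ +-comm _ _ ⟩
      φ (suc N) + ∑ (suc N ℕ.∸ u) (λ x → φ (suc N ℕ.∸ suc x))    ≈⟨ ∑-first (suc N ℕ.∸ u) (λ x → φ (suc N ℕ.∸ x)) ⟨
      ∑ (suc (suc N ℕ.∸ u)) (λ x → φ (suc N ℕ.∸ x))
        ≈⟨ reflexive (cong (λ n → ∑ n (λ x → φ (suc N ℕ.∸ x))) (≡.sym (ℕₚ.+-∸-assoc 1 u≤N))) ⟩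
      ∑ (suc (suc N) ℕ.∸ u) (λ x → φ (suc N ℕ.∸ x)) ∎
    ... | no u≰N = trans (trans (∑-cong-< (suc (suc N)) λ b b<N → reflexive
        (cong (λ t → when (not t) (φ b)) (dec-true (b <? u) (ℕₚ.≤-trans b<N (ℕₚ.≰⇒> u≰N)))))
        (Φ-0 (∑-linear (suc (suc N)))))
      (reflexive (cong (λ n → ∑ n (λ x → φ (suc N ℕ.∸ x))) (≡.sym (ℕₚ.m≤n⇒m∸n≡0 (ℕₚ.≰⇒> u≰N)))))

    not-<?-next : ∀ b b₂ → not (does (b <? next true b₂)) ≡ does (b₂ <? next false b)
    not-<?-next b b₂ with b <? next true b₂
    ... | yes h = ≡.trans (cong not (dec-true (b <? next true b₂) h))
                    (≡.sym (dec-false (b₂ <? next false b) (ℕₚ.≤⇒≯ (next-comp-< b b₂ h))))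
    ... | no h  = ≡.trans (cong not (dec-false (b <? next true b₂) h))
                    (≡.sym (dec-true (b₂ <? next false b) (next-comp-≮ b b₂ h)))

    -- A first letter of parity `β` repeats exactly across flags equal to `β`. For `β = false` the
    -- admissible second letters form an initial segment; for `β = true` they form a final one,
    -- which the reflection turns into an initial segment of length `next true k`.
    ∑-successors : ∀ β k (φ : ℕ → Carrier) → k < q →
      ∑ q (λ b → when (not (does (order β k <? next true b) xor β)) (φ b)) ≈ ∑ (next β k) (λ x → φ (order β x))
    ∑-successors false k φ k<q = trans
      (Φ-cong (∑-linear q) λ b → reflexive (cong (λ t → when t (φ b))
        (≡.trans (cong not (xor-identityʳ _)) (not-<?-next k b))))
      (∑-below q (next false k) φ (ℕₚ.≤-trans (next-≤ false k) k<q))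
    ∑-successors true k φ k<q = trans
      (Φ-cong (∑-linear q) λ b → reflexive (cong (λ t → when (not t) (φ b))
        (≡.trans (xor-comm _ true) (not-<?-next (order true k) b))))
      (trans (∑-above (double j) (next false (order true k)) φ)
        (reflexive (cong (λ n → ∑ n (λ x → φ (order true x))) count)))
      where
      k≤ = ℕₚ.≤-pred k<q
      count : q ℕ.∸ next false (order true k) ≡ next true k
      count rewrite odd-order true k k<q with odd k
      ... | false = ℕₚ.m∸[m∸n]≡n k≤
      ... | true  = ≡.trans (ℕₚ.+-∸-assoc 1 (ℕₚ.m∸n≤m (double j) k)) (cong suc (ℕₚ.m∸[m∸n]≡n k≤))

    G-next : ∀ ε ρ {n} (ε′ : Bool) (δ : Vec Bool n) → G y (next ε ρ) (ε′ ∷ δ) ≈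
      G y ρ (ε′ ∷ δ) + when (not (ε xor odd ρ)) (weight y ρ * G y (next ε′ ρ) δ)
    G-next ε ρ ε′ δ with ε xor odd ρ
    ... | true  = sym (+-identityʳ _)
    ... | false = refl

    -- After the pair at place `k` of row `ρ`, either the first letter drops below `ρ`, or it stays
    -- and the second letter is an admissible successor. What remains is again a partial row.
    after≈partialRow : ∀ ρ k m → k < q → after ρ (order (odd ρ) k) m ≈ partialRow ρ (next (odd ρ) k) m
    after≈partialRow ρ k zero    k<q = *-identityˡ _
    after≈partialRow ρ k (suc m) k<q = begin
      ∑ q (λ b → ΣW q m (λ w → G y (next (flag b) ρ) (headFlag b w ∷ wordDescents w) * (weight z b * wordWeight z w)))
        ≈⟨ Φ-cong (∑-linear q) (λ b → trans (Φ-cong (ΣW-linear q m) (λ w → expand b w))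
             (trans (Φ-+ (ΣW-linear q m) _ _) (+-congˡ (trans (Φ-when (ΣW-linear q m) (test b) _)
               (when-cong (test b) (Φ-* (ΣW-linear q m) (weight y ρ * weight z b) _)))))) ⟩
      ∑ q (λ b → ΣW q m (λ w → G y ρ (wordDescents (b ∷ w)) * wordWeight z (b ∷ w))
                 + when (test b) (weight y ρ * weight z b * after ρ b m))
        ≈⟨ Φ-+ (∑-linear q) _ _ ⟩
      biwords ρ (suc m) + ∑ q (λ b → when (test b) (weight y ρ * weight z b * after ρ b m))
        ≈⟨ +-congˡ (∑-successors (odd ρ) k _ k<q) ⟩
      biwords ρ (suc m) + ∑ (next (odd ρ) k) (λ x → weight y ρ * weight z (order (odd ρ) x) * after ρ (order (odd ρ) x) m)
        ≈⟨ +-congˡ (trans (Φ-cong (∑-linear (next (odd ρ) k)) (λ x → *-assoc _ _ _)) (Φ-* (∑-linear (next (odd ρ) k)) _ _)) ⟩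
      partialRow ρ (next (odd ρ) k) (suc m) ∎
      where
      flag test : ℕ → Bool
      flag b = does (order (odd ρ) k <? next true b)
      test b = not (flag b xor odd ρ)
      expand : ∀ b w → G y (next (flag b) ρ) (headFlag b w ∷ wordDescents w) * (weight z b * wordWeight z w)
        ≈ G y ρ (wordDescents (b ∷ w)) * wordWeight z (b ∷ w)
          + when (test b) (weight y ρ * weight z b * (G y (next (headFlag b w) ρ) (wordDescents w) * wordWeight z w))
      expand b w = trans (*-congʳ (G-next (flag b) ρ (headFlag b w) (wordDescents w)))
        (trans (distribʳ _ _ _) (+-congˡ (trans (*-comm _ _) (trans (when-* (test b) _ _) (when-cong (test b)
          (solve 4 (λ a b c d → a :* b :* (c :* d) := c :* a :* (d :* b)) refl
            (weight z b) (wordWeight z w) (weight y ρ) (G y (next (headFlag b w) ρ) (wordDescents w))))))))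

    -- The extra sequences begin with the pair at place `k`. It may occur again exactly if `ρ` and
    -- `k` have equal parity, so the recursion is that of `1/(1 - wx)` or of `1 + wx`, with `w` the
    -- weight of the pair.
    partialRow-suc : ∀ ρ k m → k < q → partialRow ρ (suc k) (suc m) ≈
      partialRow ρ k (suc m) + weight y ρ * weight z (order (odd ρ) k) * partialRow ρ (next (odd ρ) k) m
    partialRow-suc ρ k m k<q = trans
      (+-congˡ (*-congˡ (+-congˡ (*-congˡ (after≈partialRow ρ k m k<q)))))
      (solve 5 (λ a b c d e → a :+ b :* (c :+ d :* e) := a :+ b :* c :+ b :* d :* e) refl _ _ _ _ _)

    partialRow-zero : ∀ ρ m → partialRow ρ 0 m ≈ biwords ρ m
    partialRow-zero ρ zero    = sym (*-identityˡ _)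
    partialRow-zero ρ (suc m) = trans (+-congˡ (zeroʳ _)) (+-identityʳ _)

    partialRow-full : ∀ ρ m → partialRow ρ q m ≈ biwords (suc ρ) m
    partialRow-full ρ zero    = sym (*-identityˡ _)
    partialRow-full ρ (suc m) = sym (begin
      ∑ q (λ b → ΣW q m (λ w → (G y ρ (wordDescents (b ∷ w)) + weight y ρ * G y (next (headFlag b w) ρ) (wordDescents w))
                                 * (weight z b * wordWeight z w)))
        ≈⟨ Φ-cong (∑-linear q) (λ b → trans (Φ-cong (ΣW-linear q m) (λ w →
             solve 5 (λ a b c d e → (a :+ b :* c) :* (d :* e) := a :* (d :* e) :+ b :* (d :* (c :* e))) refl _ _ _ _ _))
             (trans (Φ-+ (ΣW-linear q m) _ _) (+-congˡ (trans (Φ-* (ΣW-linear q m) _ _) (*-congˡ (Φ-* (ΣW-linear q m) _ _)))))) ⟩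
      ∑ q (λ b → ΣW q m (λ w → G y ρ (wordDescents (b ∷ w)) * wordWeight z (b ∷ w)) + weight y ρ * (weight z b * after ρ b m))
        ≈⟨ trans (Φ-+ (∑-linear q) _ _) (+-congˡ (Φ-* (∑-linear q) _ _)) ⟩
      biwords ρ (suc m) + weight y ρ * ∑ q (λ b → weight z b * after ρ b m)
        ≈⟨ +-congˡ (*-congˡ (reorder (odd ρ) (λ b → weight z b * after ρ b m))) ⟩
      partialRow ρ q (suc m) ∎)
      where
      reorder : ∀ β (φ : ℕ → Carrier) → ∑ q φ ≈ ∑ q (λ x → φ (order β x))
      reorder false φ = refl
      reorder true  φ = ∑-above (double j) 0 φ

    biwords-zero : ∀ m → biwords 0 (suc m) ≈ 0#
    biwords-zero m = trans (Φ-cong (ΣW-linear q (suc m)) {g = λ _ → 0#} zero-letters) (Φ-0 (ΣW-linear q (suc m)))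
      where
      zero-letters : ∀ w → G y 0 (wordDescents w) * wordWeight z w ≈ 0#
      zero-letters (b ∷ w) = zeroˡ _

-- Generating functions

module GeometricSeries {c ℓ : Level} (K : CommutativeRing c ℓ) where
  open CommutativeRing K hiding (zero)
  open AbelianGroupProperties +-abelianGroup using () renaming (∙-cancelʳ to +-cancelʳ)
  open SemiringSolver commutativeSemiring using (solve; _:+_; _:*_; _:=_; con)
  open SetoidReasoning setoid

  -- Division by `1 - v` by cancellation: adding `v * w * x` to either side of the conclusion gives
  -- `w * x`.
  solve-geometric : ∀ {v w x u} → w ≈ 1# + v * w → x ≈ u + v * x → x ≈ w * u
  solve-geometric {v} {w} {x} {u} hw hx = +-cancelʳ (v * w * x) x (w * u) (begin
    x + v * w * x          ≈⟨ solve 3 (λ x v w → x :+ v :* w :* x := (con 1 :+ v :* w) :* x) refl x v w ⟩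
    (1# + v * w) * x       ≈⟨ *-congʳ hw ⟨
    w * x                  ≈⟨ *-congˡ hx ⟩
    w * (u + v * x)        ≈⟨ solve 4 (λ x v w u → w :* (u :+ v :* x) := w :* u :+ v :* w :* x) refl x v w u ⟩
    w * u + v * w * x      ∎)

module OneSided {c ℓ : Level} (R K : CommutativeRing c ℓ)
  (ι : CommutativeRing.Carrier R → CommutativeRing.Carrier K)
  (ι-cong : ∀ {a b} → CommutativeRing._≈_ R a b → CommutativeRing._≈_ K (ι a) (ι b))
  (ι-0 : CommutativeRing._≈_ K (ι (CommutativeRing.0# R)) (CommutativeRing.0# K))
  (V : CommutativeRing.Carrier K) (embedding : Embedding R K ι V)
  (y : CommutativeRing.Carrier R)
  where
  private module R = CommutativeRing R
  open CommutativeRing K hiding (zero)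
  open Embedding embedding
  open GeometricSeries K
  open Words R using (G)
  open Exp commutativeSemiring using (_^_; ^-homo-*; ^-congʳ)
  open SemiringSolver commutativeSemiring using (solve; _:+_; _:*_; _:=_; con)
  open SetoidReasoning setoid

  -- `half` forbids the code `2i`, which stands for the letter 0. Even bounds arise from `next`, so
  -- the two counts have to be computed together.
  full half : ∀ {n} → Vec Bool n → ℕ → R.Carrier
  full δ i = G y (suc (double i)) δ
  half δ i = G y (double i) δ

  -- This and the next three equations split off the largest code, `2i` of weight 1 or `2i+1` of
  -- weight `y`. By parity, a flag `false` leads on only to `full δ`, a flag `true` only to
  -- `half δ`.
  full-false : ∀ {n} (δ : Vec Bool n) i → full (false ∷ δ) i R.≈ half (false ∷ δ) i R.+ full δ i
  full-false δ i rewrite odd-double i = R.+-congˡ (R.*-identityˡ _)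

  half-false : ∀ {n} (δ : Vec Bool n) i → half (false ∷ δ) (suc i) R.≈ full (false ∷ δ) i R.+ y R.* full δ i
  half-false δ i rewrite odd-double i = R.refl

  full-true : ∀ {n} (δ : Vec Bool n) i → full (true ∷ δ) i R.≈ half (true ∷ δ) i R.+ half δ i
  full-true δ i rewrite odd-double i = R.+-congˡ (R.*-identityˡ _)

  half-true : ∀ {n} (δ : Vec Bool n) i → half (true ∷ δ) (suc i) R.≈ full (true ∷ δ) i R.+ y R.* half δ (suc i)
  half-true δ i rewrite odd-double i = R.refl

  -- The hypothesis holds for nonempty `δ`, as no letter is below 0, whereas the empty sequence
  -- counts 1. The closing `false` of `descents` guarantees that a flag `true` is always followed by
  -- a nonempty `δ`.
  emb-half : ∀ {n} (δ : Vec Bool n) → half δ 0 R.≈ R.0# → emb (half δ) ≈ V * emb (half δ ∘ suc)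
  emb-half δ h = trans (emb-step (half δ)) (trans (+-congʳ (trans (ι-cong h) ι-0)) (+-identityˡ _))

  module _ (W : Carrier) (W-unfold : W ≈ 1# + V * W) where

    emb-one : emb (λ _ → R.1#) ≈ W * ι R.1#
    emb-one = solve-geometric W-unfold (emb-step (λ _ → R.1#))

    private
      split-full-false : ∀ {n} (δ : Vec Bool n) → emb (full (false ∷ δ)) ≈ emb (half (false ∷ δ)) + emb (full δ)
      split-full-false δ = trans (emb-cong (full-false δ)) (emb-+ _ _)

      split-half-false : ∀ {n} (δ : Vec Bool n) →
        emb (half (false ∷ δ)) ≈ V * (emb (full (false ∷ δ)) + ι y * emb (full δ))
      split-half-false δ = trans (emb-half (false ∷ δ) R.refl)
        (*-congˡ (trans (emb-cong (half-false δ)) (trans (emb-+ _ _) (+-congˡ (emb-scale y (full δ))))))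

      split-full-true : ∀ {n} (δ : Vec Bool n) → emb (full (true ∷ δ)) ≈ emb (half (true ∷ δ)) + emb (half δ)
      split-full-true δ = trans (emb-cong (full-true δ)) (emb-+ _ _)

      split-half-true : ∀ {n} (δ : Vec Bool n) → half δ 0 R.≈ R.0# →
        emb (half (true ∷ δ)) ≈ V * emb (full (true ∷ δ)) + ι y * emb (half δ)
      split-half-true δ h = begin
        emb (half (true ∷ δ))
          ≈⟨ emb-half (true ∷ δ) R.refl ⟩
        V * emb (half (true ∷ δ) ∘ suc)
          ≈⟨ *-congˡ (trans (emb-cong (half-true δ)) (trans (emb-+ _ _) (+-congˡ (emb-scale y (half δ ∘ suc))))) ⟩
        V * (emb (full (true ∷ δ)) + ι y * emb (half δ ∘ suc))
          ≈⟨ solve 4 (λ v e y h → v :* (e :+ y :* h) := v :* e :+ y :* (v :* h)) refl _ _ _ _ ⟩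
        V * emb (full (true ∷ δ)) + ι y * (V * emb (half δ ∘ suc))
          ≈⟨ +-congˡ (*-congˡ (emb-half δ h)) ⟨
        V * emb (full (true ∷ δ)) + ι y * emb (half δ) ∎

    -- Here and in the next three lemmas, substituting one splitting equation into the other leaves
    -- a single unknown that recurs with the factor `V`.
    emb-full-false : ∀ {n} (δ : Vec Bool n) → emb (full (false ∷ δ)) ≈ W * ((1# + ι y * V) * emb (full δ))
    emb-full-false δ = solve-geometric W-unfold (trans (split-full-false δ) (trans (+-congʳ (split-half-false δ))
      (solve 4 (λ v e y f → v :* (e :+ y :* f) :+ f := (con 1 :+ y :* v) :* f :+ v :* e) refl
        V (emb (full (false ∷ δ))) (ι y) (emb (full δ)))))

    emb-half-false : ∀ {n} (δ : Vec Bool n) → emb (half (false ∷ δ)) ≈ W * (V * (1# + ι y) * emb (full δ))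
    emb-half-false δ = solve-geometric W-unfold (trans (split-half-false δ) (trans (*-congˡ (+-congʳ (split-full-false δ)))
      (solve 4 (λ v h y f → v :* (h :+ f :+ y :* f) := v :* (con 1 :+ y) :* f :+ v :* h) refl
        V (emb (half (false ∷ δ))) (ι y) (emb (full δ)))))

    emb-full-true : ∀ {n} (δ : Vec Bool n) → half δ 0 R.≈ R.0# →
      emb (full (true ∷ δ)) ≈ W * ((1# + ι y) * emb (half δ))
    emb-full-true δ h₀ = solve-geometric W-unfold (trans (split-full-true δ) (trans (+-congʳ (split-half-true δ h₀))
      (solve 4 (λ v e y h → v :* e :+ y :* h :+ h := (con 1 :+ y) :* h :+ v :* e) refl
        V (emb (full (true ∷ δ))) (ι y) (emb (half δ)))))

    emb-half-true : ∀ {n} (δ : Vec Bool n) → half δ 0 R.≈ R.0# →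
      emb (half (true ∷ δ)) ≈ W * ((ι y + V) * emb (half δ))
    emb-half-true δ h₀ = solve-geometric W-unfold (trans (split-half-true δ h₀) (trans (+-congʳ (*-congˡ (split-full-true δ)))
      (solve 4 (λ v h′ y h → v :* (h′ :+ h) :+ y :* h := (y :+ v) :* h :+ v :* h′) refl
        V (emb (half (true ∷ δ))) (ι y) (emb (half δ)))))

    module _ (ι-1 : ι R.1# ≈ 1#) (Z : Carrier) (Z-inverse : (1# + ι y * V) * Z ≈ 1#) where

      private
        A B C : Carrier
        A = 1# + ι y
        B = ι y + V
        C = 1# + ι y * V

        monomial : ℕ → ℕ → ℕ → ℕ → ℕ → Carrier
        monomial α s k n t = A ^ α * V ^ s * B ^ k * C ^ n * (Z ^ t * Z ^ k) * W ^ suc n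

        half-descents-zero : ∀ {n} b (w : Vec ℕ n) → half (descents (b ∷ w)) 0 R.≈ R.0#
        half-descents-zero b []      = R.refl
        half-descents-zero b (_ ∷ _) = R.refl

        cancel-Z : ∀ x → x ≈ C * Z * x
        cancel-Z x = trans (sym (*-identityˡ x)) (*-congʳ (sym Z-inverse))

      -- `HalfForm` describes a tail preceded by a descent. Built from the right, a run pays `V * A`
      -- where it ends, `B` for each continuation and another `A` where it starts; a run whose start
      -- lies before `δ` has paid only the first part, hence the odd exponent. Only the flags
      -- `false` outside these steps produce a `C`; `cancel-Z` supplies `C * Z` elsewhere, so `C`
      -- gets exponent `n` and `Z` counts starts, ends and continuations.
      FullForm HalfForm : ∀ {n} → Vec Bool n → Set ℓ
      FullForm {n} δ = let α = starts false δ in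
        emb (full δ) ≈ monomial (double α) α (conts false δ) n (double α)
      HalfForm {n} δ = let α = starts true δ in
        emb (half δ) ≈ monomial (suc (double α)) (suc α) (conts true δ) n (suc (double α))

      form-nil : FullForm []
      form-nil = trans emb-one (trans (*-congˡ ι-1)
        (solve 1 (λ w → w :* con 1 := con 1 :* con 1 :* con 1 :* con 1 :* (con 1 :* con 1) :* (w :* con 1)) refl W))

      form-false : ∀ {n} (δ : Vec Bool n) → FullForm δ → FullForm (false ∷ δ) × HalfForm (false ∷ δ)
      form-false δ h =
        trans (emb-full-false δ) (trans (*-congˡ (*-congˡ h))
          (solve 8 (λ w c a v b cⁿ z wⁿ → w :* (c :* (a :* v :* b :* cⁿ :* z :* wⁿ)) := a :* v :* b :* (c :* cⁿ) :* z :* (w :* wⁿ))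
            refl W C _ _ _ _ _ _)) ,
        trans (emb-half-false δ) (trans (*-congˡ (*-congˡ (trans h (cancel-Z _))))
          (solve 12 (λ w v a c z aᵅ vˢ bᵏ cⁿ zᵗ zᵏ wⁿ →
              w :* (v :* a :* (c :* z :* (aᵅ :* vˢ :* bᵏ :* cⁿ :* (zᵗ :* zᵏ) :* wⁿ)))
              := a :* aᵅ :* (v :* vˢ) :* bᵏ :* (c :* cⁿ) :* (z :* zᵗ :* zᵏ) :* (w :* wⁿ))
            refl W V A C Z _ _ _ _ _ _ _))

      form-true : ∀ {n} (δ : Vec Bool n) → half δ 0 R.≈ R.0# → HalfForm δ → FullForm (true ∷ δ) × HalfForm (true ∷ δ)
      form-true δ h₀ h =
        trans (emb-full-true δ h₀) (trans (*-congˡ (*-congˡ (trans h (cancel-Z _))))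
          (solve 11 (λ w a c z aᵅ vˢ bᵏ cⁿ zᵗ zᵏ wⁿ →
              w :* (a :* (c :* z :* (aᵅ :* vˢ :* bᵏ :* cⁿ :* (zᵗ :* zᵏ) :* wⁿ)))
              := a :* aᵅ :* vˢ :* bᵏ :* (c :* cⁿ) :* (z :* zᵗ :* zᵏ) :* (w :* wⁿ))
            refl W A C Z _ _ _ _ _ _ _)) ,
        trans (emb-half-true δ h₀) (trans (*-congˡ (*-congˡ (trans h (cancel-Z _))))
          (solve 11 (λ w b c z aᵅ vˢ bᵏ cⁿ zᵗ zᵏ wⁿ →
              w :* (b :* (c :* z :* (aᵅ :* vˢ :* bᵏ :* cⁿ :* (zᵗ :* zᵏ) :* wⁿ)))
              := aᵅ :* vˢ :* (b :* bᵏ) :* (c :* cⁿ) :* (zᵗ :* (z :* zᵏ)) :* (w :* wⁿ))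
            refl W B C Z _ _ _ _ _ _ _))

      form-descents : ∀ {n} b (w : Vec ℕ n) → FullForm (descents (b ∷ w)) × HalfForm (descents (b ∷ w))
      form-descents b []      = form-false [] form-nil
      form-descents a (b ∷ w) = cases (b <ᵇ a) (form-descents b w)
        where
        δ = descents (b ∷ w)
        cases : ∀ ε → FullForm δ × HalfForm δ → FullForm (ε ∷ δ) × HalfForm (ε ∷ δ)
        cases false (f , h) = form-false δ f
        cases true  (f , h) = form-true δ (half-descents-zero b w) h

      full-form : ∀ {n} (w : Vec ℕ n) → FullForm (descents w)
      full-form []      = form-nil
      full-form (b ∷ w) = proj₁ (form-descents b w)

      emb-full-descents : ∀ {n} (w : Vec ℕ n) → AdjacentDistinct w → let a = lpk (toList w) ; d = des (toList w) in
        A ^ (2 ℕ.* a) * V ^ a * B ^ (d ℕ.∸ a) * C ^ n * Z ^ (a ℕ.+ d) * W ^ suc n ≈ emb (full (descents w))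
      emb-full-descents {n} w h = trans
        (*-congʳ (*-cong (*-congʳ (*-cong (*-cong
          (^-congʳ A (≡.trans (cong (2 ℕ.*_) a≡) (≡.sym (double≡2* α))))
          (^-congʳ V a≡)) (^-congʳ B (≡.trans (cong₂ ℕ._∸_ d≡ a≡) (ℕₚ.m+n∸m≡n α κ)))))
          (trans (^-congʳ Z e≡) (^-homo-* Z (double α) κ))))
        (sym (full-form w))
        where
        α = starts false (descents w)
        κ = conts false (descents w)
        a≡ : lpk (toList w) ≡ α
        a≡ = lpk≡starts w h
        d≡ : des (toList w) ≡ α ℕ.+ κ
        d≡ = des≡starts+conts false w
        e≡ : lpk (toList w) ℕ.+ des (toList w) ≡ double α ℕ.+ κ
        e≡ = ≡.trans (cong₂ ℕ._+_ a≡ d≡) (≡.trans (≡.sym (ℕₚ.+-assoc α α κ))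
          (cong (ℕ._+ κ) (≡.trans (cong (α ℕ.+_) (≡.sym (ℕₚ.+-identityʳ α))) (≡.sym (double≡2* α)))))

double-mono : ∀ {m n} → m ≤ n → double m ≤ double n
double-mono z≤n     = z≤n
double-mono (s≤s h) = s≤s (s≤s (double-mono h))

-- The product formula for sequences of pairs

module TwoSided {c ℓ : Level} (R K : CommutativeRing c ℓ)
  (ι : CommutativeRing.Carrier R → CommutativeRing.Carrier K)
  (ι-cong : ∀ {a b} → CommutativeRing._≈_ R a b → CommutativeRing._≈_ K (ι a) (ι b))
  (ι-0 : CommutativeRing._≈_ K (ι (CommutativeRing.0# R)) (CommutativeRing.0# K))
  (ι-1 : CommutativeRing._≈_ K (ι (CommutativeRing.1# R)) (CommutativeRing.1# K))
  (V : CommutativeRing.Carrier K) (embedding : Embedding R K ι V)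
  (y z : CommutativeRing.Carrier R)
  where
  private module R = CommutativeRing R
  open CommutativeRing K hiding (zero)
  open Embedding embedding
  open GeometricSeries K
  open Words R using (weight; module Pairs)
  open Exp commutativeSemiring using (_^_; ^-congʳ; ^-assocʳ; ^-distrib-*)
  open SemiringSolver commutativeSemiring using (solve; _:+_; _:*_; _:=_; con)
  open SetoidReasoning setoid

  emb-recurrence : ∀ {f g h k} → f 0 R.≈ g 0 → (∀ n → f (suc n) R.≈ g (suc n) R.+ k R.* h n) →
    emb f ≈ emb g + ι k * (V * emb h)
  emb-recurrence {f} {g} {h} {k} p q = begin
    emb f                                              ≈⟨ emb-step f ⟩
    ι (f 0) + V * emb (f ∘ suc)                        ≈⟨ +-cong (ι-cong p) (*-congˡ
      (trans (emb-cong q) (trans (emb-+ (g ∘ suc) _) (+-congˡ (emb-scale k h))))) ⟩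
    ι (g 0) + V * (emb (g ∘ suc) + ι k * emb h)
      ≈⟨ solve 5 (λ a v b k h → a :+ v :* (b :+ k :* h) := a :+ v :* b :+ k :* (v :* h)) refl _ _ _ _ _ ⟩
    ι (g 0) + V * emb (g ∘ suc) + ι k * (V * emb h)    ≈⟨ +-congʳ (emb-step g) ⟨
    emb g + ι k * (V * emb h)                          ∎

  emb-0 : emb (λ _ → R.0#) ≈ 0#
  emb-0 = trans (emb-cong λ _ → R.sym (R.zeroˡ R.0#))
    (trans (emb-scale R.0# (λ _ → R.0#)) (trans (*-congʳ ι-0) (zeroˡ _)))

  module _ (W W′ : Carrier) (W-unfold : W ≈ 1# + V * W) (W′-unfold : W′ ≈ 1# + ι (y R.* z) * V * W′) (j : ℕ) where
    open Pairs y z j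

    -- The arguments are the parities of the first and second letter: a geometric series if they
    -- agree, since the pair may repeat, and two terms otherwise.
    factor : Bool → Bool → Carrier
    factor false false = W
    factor false true  = 1# + ι z * V
    factor true  false = 1# + ι y * V
    factor true  true  = W′

    emb-partialRow : ∀ ρ k → k < q → emb (partialRow ρ (suc k)) ≈ factor (odd ρ) (odd k) * emb (partialRow ρ k)
    emb-partialRow ρ k k<q = cases (odd ρ) (odd k) (trans
      (emb-recurrence {k = weight y ρ R.* weight z (order (odd ρ) k)} R.refl (λ m → partialRow-suc ρ k m k<q))
      (reflexive (cong (λ γ → p + ι (weight y ρ R.* (if γ then z else R.1#)) * (V * emb (partialRow ρ (next (odd ρ) k))))
        (odd-order (odd ρ) k k<q))))
      where
      x p : Carrier
      x = emb (partialRow ρ (suc k))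
      p = emb (partialRow ρ k)
      product : ∀ {a} → x ≈ p + ι a * (V * p) → x ≈ (1# + ι a * V) * p
      product h = trans h (solve 3 (λ a v p → p :+ a :* (v :* p) := (con 1 :+ a :* v) :* p) refl _ _ _)
      cases : ∀ β γ → x ≈ p + ι ((if β then y else R.1#) R.* (if γ then z else R.1#))
                              * (V * emb (partialRow ρ (if β xor γ then k else suc k))) → x ≈ factor β γ * p
      cases false false h = solve-geometric W-unfold (trans h (+-congˡ
        (trans (*-congʳ (trans (ι-cong (R.*-identityˡ R.1#)) ι-1)) (*-identityˡ _))))
      cases false true  h = product (trans h (+-congˡ (*-congʳ (ι-cong (R.*-identityˡ z)))))
      cases true  false h = product (trans h (+-congˡ (*-congʳ (ι-cong (R.*-identityʳ y)))))
      cases true  true  h = solve-geometric W′-unfold (trans h (+-congˡ (sym (*-assoc _ _ _))))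

    -- Places alternate in parity, so the first `2x+1` of them contain `suc x` even and `x` odd
    -- ones. The rows are counted in the same way in `emb-biwords-rows`.
    emb-partialRow-odd : ∀ ρ x → x ≤ j → let β = odd ρ in
      emb (partialRow ρ (suc (double x))) ≈ factor β false ^ suc x * factor β true ^ x * emb (partialRow ρ 0)
    emb-partialRow-odd ρ zero    x≤j = trans (emb-partialRow ρ 0 (s≤s z≤n))
      (*-congʳ (solve 1 (λ f → f := f :* con 1 :* con 1) refl _))
    emb-partialRow-odd ρ (suc x) x<j = begin
      emb (partialRow ρ (suc (suc (suc (double x)))))
        ≈⟨ emb-partialRow ρ (suc (suc (double x))) (s≤s bound) ⟩
      factor β (not (not (odd (double x)))) * emb (partialRow ρ (suc (suc (double x))))
        ≈⟨ *-cong (reflexive (cong (λ b → factor β (not (not b))) (odd-double x)))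
             (emb-partialRow ρ (suc (double x)) (ℕₚ.m≤n⇒m≤1+n bound)) ⟩
      factor β false * (factor β (not (odd (double x))) * emb (partialRow ρ (suc (double x))))
        ≈⟨ *-congˡ (*-cong (reflexive (cong (λ b → factor β (not b)) (odd-double x)))
             (emb-partialRow-odd ρ x (ℕₚ.<⇒≤ x<j))) ⟩
      factor β false * (factor β true * (factor β false ^ suc x * factor β true ^ x * emb (partialRow ρ 0)))
        ≈⟨ solve 5 (λ a b c d e → a :* (b :* (c :* d :* e)) := a :* c :* (b :* d) :* e) refl _ _ _ _ _ ⟩
      factor β false ^ suc (suc x) * factor β true ^ suc x * emb (partialRow ρ 0) ∎
      where
      β = odd ρ
      bound : suc (suc (double x)) ≤ double j
      bound = double-mono x<j

    rowFactor : Bool → Carrier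
    rowFactor β = factor β false ^ suc j * factor β true ^ j

    emb-biwords-suc : ∀ ρ → emb (biwords (suc ρ)) ≈ rowFactor (odd ρ) * emb (biwords ρ)
    emb-biwords-suc ρ = trans (sym (emb-cong (partialRow-full ρ)))
      (trans (emb-partialRow-odd ρ j ℕₚ.≤-refl) (*-congˡ (emb-cong (partialRow-zero ρ))))

    emb-biwords-zero : emb (biwords 0) ≈ 1#
    emb-biwords-zero = begin
      emb (biwords 0)                               ≈⟨ emb-step (biwords 0) ⟩
      ι (R.1# R.* R.1#) + V * emb (biwords 0 ∘ suc) ≈⟨ +-cong (trans (ι-cong (R.*-identityˡ R.1#)) ι-1)
        (*-congˡ (trans (emb-cong biwords-zero) emb-0)) ⟩
      1# + V * 0#                                   ≈⟨ trans (+-congˡ (zeroʳ V)) (+-identityʳ 1#) ⟩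
      1#                                            ∎

    emb-biwords-rows : ∀ i → emb (biwords (suc (double i))) ≈ rowFactor false ^ suc i * rowFactor true ^ i
    emb-biwords-rows zero    = trans (emb-biwords-suc 0) (*-cong (sym (*-identityʳ _)) emb-biwords-zero)
    emb-biwords-rows (suc i) = begin
      emb (biwords (suc (suc (suc (double i)))))
        ≈⟨ emb-biwords-suc (suc (suc (double i))) ⟩
      rowFactor (not (not (odd (double i)))) * emb (biwords (suc (suc (double i))))
        ≈⟨ *-cong (reflexive (cong (λ b → rowFactor (not (not b))) (odd-double i))) (emb-biwords-suc (suc (double i))) ⟩
      rowFactor false * (rowFactor (not (odd (double i))) * emb (biwords (suc (double i))))
        ≈⟨ *-congˡ (*-cong (reflexive (cong (λ b → rowFactor (not b)) (odd-double i))) (emb-biwords-rows i)) ⟩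
      rowFactor false * (rowFactor true * (rowFactor false ^ suc i * rowFactor true ^ i))
        ≈⟨ solve 4 (λ a b c d → a :* (b :* (c :* d)) := a :* c :* (b :* d)) refl _ _ _ _ ⟩
      rowFactor false ^ suc (suc i) * rowFactor true ^ suc i ∎

    rowFactor-^ : ∀ β n → rowFactor β ^ n ≈ factor β false ^ (n ℕ.* suc j) * factor β true ^ (n ℕ.* j)
    rowFactor-^ β n = trans (^-distrib-* (factor β false ^ suc j) (factor β true ^ j) n)
      (*-cong (trans (^-assocʳ (factor β false) (suc j) n) (^-congʳ (factor β false) (ℕₚ.*-comm (suc j) n)))
              (trans (^-assocʳ (factor β true) j n) (^-congʳ (factor β true) (ℕₚ.*-comm j n))))

    emb-biwords : ∀ i → emb (biwords (suc (double i))) ≈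
      (1# + ι y * V) ^ (i ℕ.* suc j) * (1# + ι z * V) ^ (suc i ℕ.* j) * W′ ^ (i ℕ.* j) * W ^ (suc i ℕ.* suc j)
    emb-biwords i = trans (emb-biwords-rows i) (trans (*-cong (rowFactor-^ false (suc i)) (rowFactor-^ true i))
      (solve 4 (λ a b c d → a :* b :* (c :* d) := c :* b :* d :* a) refl
        (W ^ (suc i ℕ.* suc j)) ((1# + ι z * V) ^ (suc i ℕ.* j)) ((1# + ι y * V) ^ (i ℕ.* suc j)) (W′ ^ (i ℕ.* j))))

-- Coefficients of the two sides

module Coefficients {c ℓ : Level} (R : CommutativeRing c ℓ) (y z : CommutativeRing.Carrier R) where
  open CommutativeRing R hiding (zero)
  open Series R
  open Thm41 R y z
  open SumTo R
  open TrivariateSeries R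
  open FiniteSums R
  open Linear
  open Words R
  private module K = CommutativeRing seriesRing
  open Exp K.commutativeSemiring using (_^_; ^-congˡ)
  open CommutativeSemigroupProperties K.*-commutativeSemigroup using (interchange)

  pow≈^ : ∀ f k → pow f k ≈ₛ f ^ k
  pow≈^ f zero    = K.refl
  pow≈^ f (suc k) = K.*-congˡ {f} (pow≈^ f k)

  geo-inverse : ∀ k V → V 0 0 0 ≈ 0# → (const 1# ⊕ sc k V) ⊗ geo (sc (- k) V) ≈ₛ const 1#
  geo-inverse k V V₀ = begin
    (const 1# ⊕ const k ⊗ V) ⊗ Z                              ≈⟨ K.distribʳ Z (const 1#) (const k ⊗ V) ⟩
    const 1# ⊗ Z ⊕ const k ⊗ V ⊗ Z
      ≈⟨ K.+-congʳ {const k ⊗ V ⊗ Z} (K.trans (K.*-identityˡ Z)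
           (geo-unfold (sc (- k) V) (trans (const-⊗ (- k) V 0 0 0) (trans (*-congˡ V₀) (zeroʳ _))))) ⟩
    const 1# ⊕ const (- k) ⊗ V ⊗ Z ⊕ const k ⊗ V ⊗ Z
      ≈⟨ K.+-assoc (const 1#) (const (- k) ⊗ V ⊗ Z) (const k ⊗ V ⊗ Z) ⟩
    const 1# ⊕ (const (- k) ⊗ V ⊗ Z ⊕ const k ⊗ V ⊗ Z)
      ≈⟨ K.+-congˡ {const 1#} (K.distribʳ Z (const (- k) ⊗ V) (const k ⊗ V)) ⟨
    const 1# ⊕ (const (- k) ⊗ V ⊕ const k ⊗ V) ⊗ Z
      ≈⟨ K.+-congˡ {const 1#} (K.*-congʳ {Z} (K.trans (K.sym (K.distribʳ V (const (- k)) (const k)))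
           (K.trans (K.*-congʳ {V} (K.trans (K.sym (const-+ (- k) k)) (K.trans (const-cong (-‿inverseˡ k)) const-0)))
             (K.zeroˡ V)))) ⟩
    const 1# ⊕ K.0# ⊗ Z                                       ≈⟨ K.+-congˡ {const 1#} (K.zeroˡ Z) ⟩
    const 1# ⊕ K.0#                                           ≈⟨ K.+-identityʳ (const 1#) ⟩
    const 1#                                                  ∎
    where
    open SetoidReasoning K.setoid
    Z = geo (sc (- k) V)

  oneSided : ∀ k V (E : Embedding R seriesRing const V) → V 0 0 0 ≈ 0# → ∀ {n} (w : Vec ℕ n) → AdjacentDistinct w →
    let a = lpk (toList w) ; d = des (toList w) in
    pow (const (1# + k)) (2 ℕ.* a) ⊗ pow V a ⊗ pow (const k ⊕ V) (d ℕ.∸ a) ⊗ pow (const 1# ⊕ sc k V) n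
      ⊗ pow (geo (sc (- k) V)) (a ℕ.+ d) ⊗ pow (geo V) (suc n)
    ≈ₛ Embedding.emb E (λ i → G k (suc (double i)) (descents w))
  oneSided k V E V₀ {n} w h = K.trans
    (K.*-cong (K.*-cong (K.*-cong (K.*-cong (K.*-cong
      (K.trans (pow≈^ (const (1# + k)) (2 ℕ.* a)) (^-congˡ (2 ℕ.* a) (const-+ 1# k)))
      (pow≈^ V a)) (pow≈^ (const k ⊕ V) (d ℕ.∸ a))) (pow≈^ (const 1# ⊕ sc k V) n))
      (pow≈^ (geo (sc (- k) V)) (a ℕ.+ d))) (pow≈^ (geo V) (suc n)))
    (OneSided.emb-full-descents R seriesRing const const-cong const-0 V E k (geo V) (geo-unfold V V₀)
      K.refl (geo (sc (- k) V)) (geo-inverse k V V₀) w h)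
    where
    a = lpk (toList w)
    d = des (toList w)

  geo≈emb-one : ∀ V (E : Embedding R seriesRing const V) → V 0 0 0 ≈ 0# → geo V ≈ₛ Embedding.emb E (λ _ → 1#)
  geo≈emb-one V E V₀ = K.sym (K.trans (OneSided.emb-one R seriesRing const const-cong const-0 V E 1# (geo V) (geo-unfold V V₀))
    (K.*-identityʳ (geo V)))

  countS countT : ∀ {n} → Vec ℕ n → ℕ → Carrier
  countS w i = G y (suc (double i)) (descents w)
  countT w i = G z (suc (double i)) (descents w)

  evalTerm-⊗ : ∀ {n} (π σ : Vec ℕ n) → InversePair π σ →
    evalTerm n (toList π) ⊗ pow (geo S) (suc n) ⊗ pow (geo T) (suc n) ≈ₛ embS (countS π) ⊗ embT (countT σ)
  -- Rewriting replaces `inverse n (toList π)` by `toList σ`, so the inverse statistics become `des`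
  -- and `lpk` of `σ` and the term splits into a factor in `S` and a factor in `T`.
  evalTerm-⊗ {n} π σ (dπ , dσ , e) rewrite ≡.sym e = K.trans
    (K.trans (K.*-assoc (L ⊗ M) gS gT) (interchange L M gS gT))
    (K.*-cong (oneSided y S embeddingS refl π dπ) (oneSided z T embeddingT refl σ dσ))
    where
    L M gS gT : PS
    L = let a = lpk (toList π) ; d = des (toList π) in
      pow (const (1# + y)) (2 ℕ.* a) ⊗ pow S a ⊗ pow (const y ⊕ S) (d ℕ.∸ a)
        ⊗ pow (const 1# ⊕ sc y S) n ⊗ pow (geo (sc (- y) S)) (a ℕ.+ d)
    M = let b = lpk (toList σ) ; e = des (toList σ) in
      pow (const (1# + z)) (2 ℕ.* b) ⊗ pow T b ⊗ pow (const z ⊕ T) (e ℕ.∸ b)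
        ⊗ pow (const 1# ⊕ sc z T) n ⊗ pow (geo (sc (- z) T)) (b ℕ.+ e)
    gS = pow (geo S) (suc n)
    gT = pow (geo T) (suc n)

  sumList-⊗ : ∀ {A : Set} (F : A → PS) g xs m i j →
    ((λ m i j → sumList (λ a → F a m i j) xs) ⊗ g) m i j ≈ sumList (λ a → (F a ⊗ g) m i j) xs
  sumList-⊗ F g List.[]       m i j = K.zeroˡ g m i j
  sumList-⊗ F g (x List.∷ xs) m i j = trans (K.distribʳ g (F x) (λ m i j → sumList (λ a → F a m i j) xs) m i j)
    (+-congˡ (sumList-⊗ F g xs m i j))

  lhsTerm≈ΣP : ∀ n m i j → lhsTerm n m i j ≈ ΣP n (λ π σ → (embS (countS π) ⊗ embT (countT σ) ⊗ pow X n) m i j)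
  lhsTerm≈ΣP n m i j = begin
    lhsTerm n m i j
      ≈⟨ assoc (evalP n) m i j ⟩
    (evalP n ⊗ (gS ⊗ gT ⊗ pow X n)) m i j
      ≈⟨ sumList-⊗ (evalTerm n) (gS ⊗ gT ⊗ pow X n) (perms n) m i j ⟩
    sumList (λ π → (evalTerm n π ⊗ (gS ⊗ gT ⊗ pow X n)) m i j) (perms n)
      ≈⟨ sumList-perms n _ ⟩
    ΣP n (λ π σ → (evalTerm n (toList π) ⊗ (gS ⊗ gT ⊗ pow X n)) m i j)
      ≈⟨ ΣP-cong n (λ π σ h → K.trans (K.sym (assoc (evalTerm n (toList π))))
           (K.*-congʳ {pow X n} (evalTerm-⊗ π σ h)) m i j) ⟩
    ΣP n (λ π σ → (embS (countS π) ⊗ embT (countT σ) ⊗ pow X n) m i j) ∎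
    where
    open SetoidReasoning setoid
    gS gT : PS
    gS = pow (geo S) (suc n)
    gT = pow (geo T) (suc n)
    assoc : ∀ f → f ⊗ gS ⊗ gT ⊗ pow X n ≈ₛ f ⊗ (gS ⊗ gT ⊗ pow X n)
    assoc f = K.trans (K.*-congʳ {pow X n} (K.*-assoc f gS gT)) (K.*-assoc f (gS ⊗ gT) (pow X n))

  lhsTerm-off : ∀ n m i j → n ≢ m → lhsTerm n m i j ≈ 0#
  lhsTerm-off n m i j n≢m = trans (lhsTerm≈ΣP n m i j) (trans
    (ΣP-cong n λ π σ _ → ShiftX.coef-pow-off i j (embS (countS π) ⊗ embT (countT σ))
      (λ k → embS-⊗-embT-suc (countS π) (countT σ) k i j) n m n≢m)
    (Φ-0 (ΣP-linear n)))

  lhsTerm-diagonal : ∀ m i j → lhsTerm m m i j ≈ Pairs.biwords y z j (suc (double i)) m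
  lhsTerm-diagonal m i j = trans (lhsTerm≈ΣP m m i j) (trans
    (ΣP-cong m λ π σ _ → trans (ShiftX.coef-pow-diagonal i j (embS (countS π) ⊗ embT (countT σ)) m)
      (embS-⊗-embT (countS π) (countT σ) i j))
    (ΣP-words z (suc (double j)) m (G y (suc (double i)))))

  geoS⊗geoT : geo S ⊗ geo T ≈ₛ embS (λ _ → 1#) ⊗ embT (λ _ → 1#)
  geoS⊗geoT = K.*-cong (geo≈emb-one S embeddingS refl) (geo≈emb-one T embeddingT refl)

  -- The term outside the sum accounts for the empty sequence, with coefficient 1 at `m = 0`. For
  -- positive `m` the factor `pow X n` leaves only the summand `n = m`.
  LHS≈biwords : ∀ m i j → LHS m i j ≈ Pairs.biwords y z j (suc (double i)) m
  LHS≈biwords zero    i j = trans (+-identityʳ _)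
    (trans (geoS⊗geoT 0 i j) (embS-⊗-embT (λ _ → 1#) (λ _ → 1#) i j))
  LHS≈biwords (suc m) i j = trans
    (+-cong (trans (geoS⊗geoT (suc m) i j) (embS-⊗-embT-suc (λ _ → 1#) (λ _ → 1#) m i j))
      (trans (sumTo-single (suc m) (suc m) _ ℕₚ.≤-refl
        λ { zero _ → refl ; (suc k) k≢m → lhsTerm-off (suc k) (suc m) i j k≢m })
        (lhsTerm-diagonal (suc m) i j)))
    (+-identityˡ _)

  module _ (h : ℕ → Carrier) where

    embX-⊗-powS-off : ∀ a m i j → a ≢ i → (embX h ⊗ pow S a) m i j ≈ 0#
    embX-⊗-powS-off a m i j a≢i = ShiftS.coef-pow-off m j (embX h) (λ _ → refl) a i a≢i

    embX-⊗-powS-T-off : ∀ a m i j → (embX h ⊗ pow S a) m i (suc j) ≈ 0#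
    embX-⊗-powS-T-off a m i j with a ℕ.≟ i
    ... | yes ≡.refl = ShiftS.coef-pow-diagonal m (suc j) (embX h) a
    ... | no a≢i     = embX-⊗-powS-off a m i (suc j) a≢i

    embX-⊗-diagonal : ∀ m i j → (embX h ⊗ pow S i ⊗ pow T j) m i j ≈ h m
    embX-⊗-diagonal m i j = trans (ShiftT.coef-pow-diagonal m i (embX h ⊗ pow S i) j)
      (ShiftS.coef-pow-diagonal m 0 (embX h) i)

    embX-⊗-T-off : ∀ a b m i j → b ≢ j → (embX h ⊗ pow S a ⊗ pow T b) m i j ≈ 0#
    embX-⊗-T-off a b m i j = ShiftT.coef-pow-off m i (embX h ⊗ pow S a) (embX-⊗-powS-T-off a m i) b j

    embX-⊗-S-off : ∀ a b m i j → a ≢ i → (embX h ⊗ pow S a ⊗ pow T b) m i j ≈ 0#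
    embX-⊗-S-off a b m i j a≢i with b ℕ.≟ j
    ... | yes ≡.refl = trans (ShiftT.coef-pow-diagonal m i (embX h ⊗ pow S a) b) (embX-⊗-powS-off a m i 0 a≢i)
    ... | no b≢j     = embX-⊗-T-off a b m i j b≢j

  rhsTerm≈ : ∀ a b → rhsTerm a b ≈ₛ embX (Pairs.biwords y z b (suc (double a))) ⊗ pow S a ⊗ pow T b
  rhsTerm≈ a b = K.*-congʳ {pow T b} (K.*-congʳ {pow S a} (K.trans
    (K.*-cong (K.*-cong (K.*-cong
      (pow≈^ (const 1# ⊕ sc y X) (a ℕ.* suc b)) (pow≈^ (const 1# ⊕ sc z X) (suc a ℕ.* b)))
      (pow≈^ (geo (sc (y * z) X)) (a ℕ.* b))) (pow≈^ (geo X) (suc a ℕ.* suc b)))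
    (K.sym (TwoSided.emb-biwords R seriesRing const const-cong const-0 K.refl X embeddingX y z
      (geo X) (geo (sc (y * z) X)) (geo-unfold X refl)
      (geo-unfold (sc (y * z) X) (trans (const-⊗ (y * z) X 0 0 0) (zeroʳ _))) b a))))

  -- Apart from `pow S a` and `pow T b`, a summand is a series in `X` alone, so only `a = i` and
  -- `b = j` contribute.
  RHS≈biwords : ∀ m i j → RHS m i j ≈ Pairs.biwords y z j (suc (double i)) m
  RHS≈biwords m i j = trans
    (sumTo-single i i _ ℕₚ.≤-refl λ a a≢i → sumTo-zero j λ b →
      trans (rhsTerm≈ a b m i j) (embX-⊗-S-off _ a b m i j a≢i))
    (trans (sumTo-single j j _ ℕₚ.≤-refl λ b b≢j → trans (rhsTerm≈ i b m i j) (embX-⊗-T-off _ i b m i j b≢j))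
      (trans (rhsTerm≈ i j m i j) (embX-⊗-diagonal _ m i j)))

theorem4p1 : {c ℓ : Level} (R : CommutativeRing c ℓ) (y z : CommutativeRing.Carrier R)
    (m i j : ℕ) →
    CommutativeRing._≈_ R (Thm41.LHS R y z m i j) (Thm41.RHS R y z m i j)
theorem4p1 R y z m i j = trans (LHS≈biwords m i j) (sym (RHS≈biwords m i j))
  where
  open CommutativeRing R using (trans; sym)
  open Coefficients R y z
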